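{- Let $A\subseteq\{2,3,\dots,n-1\}$ be a set of $r$ multiplicatively independent generators, let $m=\min A$ and $R=\max A$, let $K>1$, and suppose that $R\le m^K$. Then $$\log m\ \ge\ \frac{\log n}{4K(r!)^{1/r}\,p_A(n)^{1/r}}.$$
   Context: For $A=\{a_1,\dots,a_r\}$, $H_A(n)=\{\prod_{i=1}^r a_i^{u_i}<n:\ u_i\in\mathbb N_0\}$ (a set, duplicates removed) and $p_A(n)=|H_A(n)|$. The generators are multiplicatively independent if distinct exponent vectors $(u_1,\dots,u_r)\in\mathbb N_0^r$ give distinct products $\prod a_i^{u_i}$. Logarithms are natural. -}

module Defs where

open import Algebra.Bundles using (CommutativeRing)
open import Data.Empty using (⊥; ⊥-elim)
import Data.Integer.Base as ℤ
import Data.Integer.Properties as ℤ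
open import Data.Nat.Base as ℕ using (ℕ; zero; suc)
import Data.Nat.Properties as ℕ
open import Data.Product using (Σ; ∃; ∃₂; _×_; _,_; proj₁; proj₂)
open import Data.Rational.Base as ℚ
  using (ℚ; 0ℚ; 1ℚ; ½; mkℚ; _+_; _*_; -_; _-_; _<_; _≤_; ∣_∣; toℚᵘ)
import Data.Rational.Properties as ℚ
open import Data.Rational.Solver using (module +-*-Solver)
open import Data.Rational.Unnormalised.Base as ℚᵘ using (mkℚᵘ)
import Data.Rational.Unnormalised.Properties as ℚᵘ
open import Data.Sum using (_⊎_; inj₁; inj₂)
open import Data.List.Base using (filter; length; upTo)
open import Data.List.Membership.Propositional.Properties using (∈-filter⁺; ∈-upTo⁺; ∈-length)
open import Data.Vec.Base as Vec using (Vec; []; _∷_)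
open import Data.Vec.Membership.Propositional using (_∈_)
open import Data.Vec.Relation.Unary.All as All using (All; []; _∷_)
open import Function.Definitions using (Injective)
open import Relation.Binary.Definitions using (tri<; tri≈; tri>)
open import Relation.Binary.PropositionalEquality
  using (_≡_; refl; sym; trans; cong; cong₂; subst; subst₂)
open import Relation.Nullary using (Dec; yes; no)
open import Relation.Nullary.Decidable using (_×-dec_; map′)
open import Algebra.Properties.CommutativeSemiring.Exp
  (CommutativeRing.commutativeSemiring ℚ.+-*-commutativeRing)
  using (_^_; ^-assocʳ; ^-distrib-*)

open +-*-Solver

-- Opaque because _/_ on ℚ normalises by a gcd, which defeats unification.
opaque
  ι : ℕ → ℚ
  ι n = ℤ.+ n ℚ./ 1

opaque
  recip : ℕ → ℚ
  recip k = ℤ.+ 1 ℚ./ suc k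

opaque
  *<ˡ : ∀ {r p q} → 0ℚ < r → p < q → r * p < r * q
  *<ˡ {r} 0<r p<q = ℚ.*-monoʳ-<-pos r {{ℚ.positive 0<r}} p<q

opaque
  *<ʳ : ∀ {r p q} → 0ℚ < r → p < q → p * r < q * r
  *<ʳ {r} 0<r p<q = ℚ.*-monoˡ-<-pos r {{ℚ.positive 0<r}} p<q

opaque
  *≤ˡ : ∀ {r p q} → 0ℚ ≤ r → p ≤ q → r * p ≤ r * q
  *≤ˡ {r} 0≤r p≤q = ℚ.*-monoˡ-≤-nonNeg r {{ℚ.nonNegative 0≤r}} p≤q

opaque
  *≤ʳ : ∀ {r p q} → 0ℚ ≤ r → p ≤ q → p * r ≤ q * r
  *≤ʳ {r} 0≤r p≤q = ℚ.*-monoʳ-≤-nonNeg r {{ℚ.nonNegative 0≤r}} p≤q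

opaque
  *≤ˡ⁻ : ∀ {r p q} → r ≤ 0ℚ → p ≤ q → r * q ≤ r * p
  *≤ˡ⁻ {r} r≤0 p≤q = ℚ.*-monoˡ-≤-nonPos r {{ℚ.nonPositive r≤0}} p≤q

opaque
  *<-cancelʳ : ∀ {r p q} → 0ℚ < r → p * r < q * r → p < q
  *<-cancelʳ {r} 0<r = ℚ.*-cancelʳ-<-nonNeg r {{ℚ.nonNegative (ℚ.<⇒≤ 0<r)}}

opaque
  0<* : ∀ {p q} → 0ℚ < p → 0ℚ < q → 0ℚ < p * q
  0<* {p} {q} 0<p 0<q = subst (_< p * q) (ℚ.*-zeroʳ p) (*<ˡ 0<p 0<q)

opaque
  0≤* : ∀ {p q} → 0ℚ ≤ p → 0ℚ ≤ q → 0ℚ ≤ p * q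
  0≤* {p} {q} 0≤p 0≤q = subst (_≤ p * q) (ℚ.*-zeroʳ p) (*≤ˡ 0≤p 0≤q)

opaque
  0<1 : 0ℚ < 1ℚ
  0<1 = ℚ.positive⁻¹ 1ℚ

opaque
  0<½ : 0ℚ < ½
  0<½ = ℚ.positive⁻¹ ½

opaque
  0<- : ∀ {p q} → p < q → 0ℚ < q - p
  0<- {p} {q} p<q = subst (_< q - p) (ℚ.+-inverseʳ p) (ℚ.+-monoˡ-< (- p) p<q)

opaque
  0≤- : ∀ {p q} → p ≤ q → 0ℚ ≤ q - p
  0≤- {p} {q} p≤q = subst (_≤ q - p) (ℚ.+-inverseʳ p) (ℚ.+-monoˡ-≤ (- p) p≤q)

opaque
  -<⁻¹ : ∀ {p q} → 0ℚ < q - p → p < q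
  -<⁻¹ {p} {q} h = subst₂ _<_ (ℚ.+-identityˡ p)
    (solve 2 (λ p q → (q :- p) :+ p := q) refl p q) (ℚ.+-monoˡ-< p h)

opaque
  -≤⁻¹ : ∀ {p q} → 0ℚ ≤ q - p → p ≤ q
  -≤⁻¹ {p} {q} h = subst₂ _≤_ (ℚ.+-identityˡ p)
    (solve 2 (λ p q → (q :- p) :+ p := q) refl p q) (ℚ.+-monoˡ-≤ p h)

opaque
  dense : ∀ {p q} → p < q → ∃ λ m → p < m × m < q
  dense = ℚ.<-dense

opaque
  <-cases : ∀ p q → p < q ⊎ q ≤ p
  <-cases p q with p ℚ.<? q
  ... | yes p<q = inj₁ p<q
  ... | no  p≮q = inj₂ (ℚ.≮⇒≥ p≮q)

opaque
  inverse : ∀ {p} → 0ℚ < p → ∃ λ i → 0ℚ < i × p * i ≡ 1ℚ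
  inverse {p} 0<p =
    (ℚ.1/ p) {{nz}} ,
    ℚ.positive⁻¹ _ {{ℚ.1/pos⇒pos p {{ℚ.positive 0<p}}}} ,
    ℚ.*-inverseʳ p {{nz}}
    where
    nz : ℚ.NonZero p
    nz = ℚ.>-nonZero 0<p

opaque
  quotient : ∀ {m η} → 0ℚ < m → 0ℚ < η → ∃ λ δ → 0ℚ < δ × m * δ ≡ η
  quotient {m} {η} 0<m 0<η with inverse 0<m
  ... | i , 0<i , mi≡1 = i * η , 0<* 0<i 0<η ,
    trans (sym (ℚ.*-assoc m i η)) (trans (cong (_* η) mi≡1) (ℚ.*-identityˡ η))

opaque
  /-ᵘ : ∀ i d → toℚᵘ (i ℚ./ suc d) ℚᵘ.≃ mkℚᵘ i d
  /-ᵘ i d = ℚ.toℚᵘ-fromℚᵘ (mkℚᵘ i d)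

opaque
  unfolding ι

  ι-suc : ∀ n → ι (suc n) ≡ 1ℚ + ι n
  ι-suc n = ℚ.toℚᵘ-injective (ℚᵘ.≃-trans (/-ᵘ (ℤ.+ suc n) 0) (ℚᵘ.≃-sym
    (ℚᵘ.≃-trans (ℚ.toℚᵘ-homo-+ 1ℚ (ι n))
    (ℚᵘ.≃-trans (ℚᵘ.+-cong (ℚᵘ.≃-refl {toℚᵘ 1ℚ}) (/-ᵘ (ℤ.+ n) 0))
    (ℚᵘ.*≡* (cong (ℤ._* ℤ.1ℤ) (cong (λ z → ℤ.1ℤ ℤ.+ z) (ℤ.*-identityʳ (ℤ.+ n)))))))))

opaque
  unfolding ι recip

  ι-recip : ∀ k → ι (suc k) * recip k ≡ 1ℚ
  ι-recip k = ℚ.toℚᵘ-injective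
    (ℚᵘ.≃-trans (ℚ.toℚᵘ-homo-* (ι (suc k)) (recip k))
    (ℚᵘ.≃-trans (ℚᵘ.*-cong (/-ᵘ (ℤ.+ suc k) 0) (/-ᵘ (ℤ.+ 1) k))
    (ℚᵘ.*≡* (trans (ℤ.*-identityʳ _) (trans (ℤ.*-identityʳ _)
      (sym (trans (ℤ.*-identityˡ _) (cong ℤ.+_ (cong suc (ℕ.+-identityʳ k))))))))))

opaque
  unfolding ι

  ι-* : ∀ m n → ι (m ℕ.* n) ≡ ι m * ι n
  ι-* zero    n = sym (ℚ.*-zeroˡ (ι n))
  ι-* (suc m) n = trans (ι-+ n (m ℕ.* n)) (trans (cong (ι n +_) (ι-* m n))
    (trans (solve 2 (λ a b → b :+ a :* b := (con 1ℚ :+ a) :* b) refl (ι m) (ι n))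
           (cong (_* ι n) (sym (ι-suc m)))))
    where
    ι-+ : ∀ m n → ι (m ℕ.+ n) ≡ ι m + ι n
    ι-+ zero    n = sym (ℚ.+-identityˡ (ι n))
    ι-+ (suc m) n = trans (ι-suc (m ℕ.+ n)) (trans (cong (1ℚ +_) (ι-+ m n))
      (trans (sym (ℚ.+-assoc 1ℚ (ι m) (ι n))) (cong (_+ ι n) (sym (ι-suc m)))))

opaque
  unfolding ι

  0≤ι : ∀ n → 0ℚ ≤ ι n
  0≤ι n = ℚ.nonNegative⁻¹ _ {{ℚ.normalize-nonNeg n 1}}

opaque
  unfolding ι

  0<ι : ∀ n .{{_ : ℕ.NonZero n}} → 0ℚ < ι n
  0<ι n = ℚ.positive⁻¹ _ {{ℚ.normalize-pos n 1}}

opaque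
  unfolding recip

  0<recip : ∀ k → 0ℚ < recip k
  0<recip k = ℚ.positive⁻¹ _ {{ℚ.normalize-pos 1 (suc k)}}

opaque
  unfolding ι

  archimedean : ∀ q → ∃ λ n → q < ι (suc n)
  archimedean q@(mkℚ n d _) = ℤ.∣ n ∣ , ℚ.toℚᵘ-cancel-<
    (ℚᵘ.<-respʳ-≃ (ℚᵘ.≃-sym (/-ᵘ (ℤ.+ suc ℤ.∣ n ∣) 0)) (ℚᵘ.*<* (ℤ.≤-<-trans
      (ℤ.≤-trans (ℤ.≤-reflexive (ℤ.*-identityʳ n)) (i≤∣i∣ n))
      (ℤ.+<+ (ℕ.≤-trans (ℕ.n<1+n ℤ.∣ n ∣) (ℕ.m≤m*n (suc ℤ.∣ n ∣) (suc d)))))))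
    where
    i≤∣i∣ : ∀ i → i ℤ.≤ ℤ.+ ℤ.∣ i ∣
    i≤∣i∣ (ℤ.+ _)     = ℤ.≤-refl
    i≤∣i∣ ℤ.-[1+ _ ] = ℤ.-≤+

opaque
  recip-small : ∀ b {δ} → 0ℚ < δ → ∃ λ k → b * recip k < δ
  recip-small b {δ} 0<δ with inverse 0<δ
  ... | i , 0<i , δi≡1 with archimedean (b * i)
  ... | k , bi<k = k , *<-cancelʳ {ι (suc k)} (0<ι (suc k))
    (subst₂ _<_
      (trans (solve 3 (λ b i δ → (b :* i) :* δ := b :* (δ :* i)) refl b i δ)
        (trans (cong (b *_) (trans δi≡1 (sym (ι-recip k))))
          (solve 3 (λ b n r → b :* (n :* r) := (b :* r) :* n) refl b (ι (suc k)) (recip k))))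
      (ℚ.*-comm (ι (suc k)) δ)
      (*<ʳ 0<δ bi<k))

opaque
  x≤∣x∣ : ∀ x → x ≤ ∣ x ∣
  x≤∣x∣ x with ℚ.≤-total 0ℚ x
  ... | inj₁ 0≤x = ℚ.≤-reflexive (sym (ℚ.0≤p⇒∣p∣≡p 0≤x))
  ... | inj₂ x≤0 = ℚ.≤-trans x≤0 (ℚ.0≤∣p∣ x)

opaque
  ^-pos : ∀ {b} n → 0ℚ < b → 0ℚ < b ^ n
  ^-pos zero    0<b = 0<1
  ^-pos (suc n) 0<b = 0<* 0<b (^-pos n 0<b)

opaque
  ^-mono : ∀ {a b} n → 0ℚ < a → a ≤ b → a ^ n ≤ b ^ n
  ^-mono zero    0<a a≤b = ℚ.≤-refl
  ^-mono (suc n) 0<a a≤b = ℚ.≤-trans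
    (*≤ʳ (ℚ.<⇒≤ (^-pos n 0<a)) a≤b)
    (*≤ˡ (ℚ.≤-trans (ℚ.<⇒≤ 0<a) a≤b) (^-mono n 0<a a≤b))

opaque
  1^n≡1 : ∀ n → 1ℚ ^ n ≡ 1ℚ
  1^n≡1 zero    = refl
  1^n≡1 (suc n) = trans (ℚ.*-identityˡ _) (1^n≡1 n)

opaque
  0≤square : ∀ h → 0ℚ ≤ h * h
  0≤square h with ℚ.≤-total 0ℚ h
  ... | inj₁ 0≤h = 0≤* 0≤h 0≤h
  ... | inj₂ h≤0 = subst (_≤ h * h) (ℚ.*-zeroʳ h) (*≤ˡ⁻ h≤0 h≤0)

opaque
  unfolding ι

  bernoulli : ∀ n {h} → 0ℚ < 1ℚ + h → 1ℚ + ι n * h ≤ (1ℚ + h) ^ n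
  bernoulli zero    {h} _ = ℚ.≤-reflexive
    (trans (cong (1ℚ +_) (ℚ.*-zeroˡ h)) (ℚ.+-identityʳ 1ℚ))
  bernoulli (suc n) {h} p = ℚ.≤-trans
    (-≤⁻¹ (subst (0ℚ ≤_)
      (trans (solve 2 (λ h m → m :* (h :* h) :=
          (con 1ℚ :+ h) :* (con 1ℚ :+ m :* h) :- (con 1ℚ :+ (con 1ℚ :+ m) :* h))
          refl h (ι n))
        (cong (λ m → (1ℚ + h) * (1ℚ + ι n * h) - (1ℚ + m * h)) (sym (ι-suc n))))
      (0≤* (0≤ι n) (0≤square h))))
    (*≤ˡ (ℚ.<⇒≤ p) (bernoulli n p))

record ℝ : Set₁ where
  no-eta-equality
  field
    L U       : ℚ → Set
    L-inhab   : ∃ L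
    U-inhab   : ∃ U
    L-down    : ∀ {p q} → p < q → L q → L p
    L-round   : ∀ {p} → L p → ∃ λ q → p < q × L q
    U-up      : ∀ {p q} → p < q → U p → U q
    U-round   : ∀ {q} → U q → ∃ λ p → p < q × U p
    disjoint  : ∀ {q} → L q → U q → ⊥
    located   : ∀ {p q} → p < q → L p ⊎ U q

open ℝ public

infix 4 _<ᴿ_ _≤ᴿ_ _≥ᴿ_

_<ᴿ_ : ℝ → ℝ → Set
x <ᴿ y = ∃ λ q → U x q × L y q

_≤ᴿ_ : ℝ → ℝ → Set
x ≤ᴿ y = ∀ q → L x q → L y q

_≥ᴿ_ : ℝ → ℝ → Set
x ≥ᴿ y = y ≤ᴿ x

-- A record, so that instance search can supply it.
record Positive (x : ℝ) : Set where
  constructor positive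
  field
    0∈L : L x 0ℚ

open Positive public

opaque
  L<U : ∀ x {p q} → L x p → U x q → p < q
  L<U x {p} {q} Lp Uq with ℚ.<-cmp p q
  ... | tri< p<q _ _ = p<q
  ... | tri≈ _ refl _ = ⊥-elim (disjoint x Lp Uq)
  ... | tri> _ _ q<p = ⊥-elim (disjoint x (L-down x q<p Lp) Uq)

opaque
  unfolding ι

  approximate : ∀ x {ε} → 0ℚ < ε → ∃₂ λ a b → L x a × U x b × b - a ≤ ε
  approximate x {ε} 0<ε with L-inhab x | U-inhab x
  ... | a , La | b , Ub = search (proj₁ overshoot) a La (proj₂ overshoot)
    where
    δ : ℚ
    δ = ε * ½
    0<δ : 0ℚ < δ
    0<δ = 0<* 0<ε 0<½
    overshoot : Σ ℕ λ n → U x (a + ι n * δ)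
    overshoot with quotient 0<δ 0<1
    ... | i , 0<i , δi≡1 with archimedean ((b - a) * i)
    ... | n , h = suc n , U-up x
      (-<⁻¹ (subst (0ℚ <_)
        (solve 3 (λ a b m → m :- (b :- a) := (a :+ m) :- b) refl a b (ι (suc n) * δ))
        (0<- (subst (_< ι (suc n) * δ)
          (trans (solve 3 (λ w i d → (w :* i) :* d := w :* (d :* i)) refl (b - a) i δ)
            (trans (cong ((b - a) *_) δi≡1) (ℚ.*-identityʳ _)))
          (*<ʳ 0<δ h)))))
      Ub
    search : ∀ n a → L x a → U x (a + ι n * δ) → ∃₂ λ a b → L x a × U x b × b - a ≤ ε
    search zero a La Ua = ⊥-elim (disjoint x La
      (subst (U x) (trans (cong (a +_) (ℚ.*-zeroˡ δ)) (ℚ.+-identityʳ a)) Ua))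
    search (suc n) a La Un
      with located x {a + δ} {a + δ + δ}
        (subst (_< a + δ + δ) (ℚ.+-identityʳ (a + δ)) (ℚ.+-monoʳ-< (a + δ) 0<δ))
    ... | inj₁ La′ = search n (a + δ) La′ (subst (U x)
      (trans (cong (λ m → a + m * δ) (ι-suc n))
        (solve 3 (λ a m d → a :+ (con 1ℚ :+ m) :* d := (a :+ d) :+ m :* d) refl a (ι n) δ))
      Un)
    ... | inj₂ Ub = a , a + δ + δ , La , Ub , ℚ.≤-reflexive
      (solve 2 (λ a e → (a :+ e :* con ½ :+ e :* con ½) :- a := e) refl a ε)

fromℚ : ℚ → ℝ
L (fromℚ q) p = p < q
U (fromℚ q) p = q < p
L-inhab (fromℚ q) = q - 1ℚ , -<⁻¹ (subst (0ℚ <_)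
  (solve 1 (λ q → con 1ℚ := q :- (q :- con 1ℚ)) refl q) 0<1)
U-inhab (fromℚ q) = q + 1ℚ , -<⁻¹ (subst (0ℚ <_)
  (solve 1 (λ q → con 1ℚ := (q :+ con 1ℚ) :- q) refl q) 0<1)
L-down (fromℚ q) = ℚ.<-trans
L-round (fromℚ q) = dense
U-up (fromℚ q) p<r q<p = ℚ.<-trans q<p p<r
U-round (fromℚ q) q<r with dense q<r
... | m , q<m , m<r = m , m<r , q<m
disjoint (fromℚ q) = ℚ.<-asym
located (fromℚ q) {p} {p′} p<p′ with <-cases p q
... | inj₁ p<q = inj₁ p<q
... | inj₂ q≤p = inj₂ (ℚ.≤-<-trans q≤p p<p′)

fromℕ : ℕ → ℝ
fromℕ n = fromℚ (ι n)

instance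
  fromℕ-positive : ∀ {n} .{{_ : ℕ.NonZero n}} → Positive (fromℕ n)
  fromℕ-positive {n} = positive (0<ι n)

>1⇒positive : ∀ {x} → fromℕ 1 <ᴿ x → Positive x
>1⇒positive {x} (q , 1<q , Lq) = positive (L-down x (ℚ.<-trans (0<ι 1) 1<q) Lq)

opaque
  -- The four corners of a box bound the product on the whole box.
  corners-below : ∀ {q a b c d s t} → a ≤ s → s ≤ b → c ≤ t → t ≤ d →
    q < a * c → q < a * d → q < b * c → q < b * d → q < s * t
  corners-below {q} {a} {b} {c} {d} {s} {t} a≤s s≤b c≤t t≤d ac ad bc bd =
    subst (q <_) (ℚ.*-comm t s)
      (edge {t} {a} {b} {s} a≤s s≤b
        (subst (q <_) (ℚ.*-comm a t) (edge {a} {c} {d} {t} c≤t t≤d ac ad))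
        (subst (q <_) (ℚ.*-comm b t) (edge {b} {c} {d} {t} c≤t t≤d bc bd)))
    where
    edge : ∀ {a c d t} → c ≤ t → t ≤ d → q < a * c → q < a * d → q < a * t
    edge {a} c≤t t≤d ac ad with ℚ.≤-total 0ℚ a
    ... | inj₁ 0≤a = ℚ.<-≤-trans ac (*≤ˡ 0≤a c≤t)
    ... | inj₂ a≤0 = ℚ.<-≤-trans ad (*≤ˡ⁻ a≤0 t≤d)

opaque
  corners-above : ∀ {q a b c d s t} → a ≤ s → s ≤ b → c ≤ t → t ≤ d →
    a * c < q → a * d < q → b * c < q → b * d < q → s * t < q
  corners-above {q} {a} {b} {c} {d} {s} {t} a≤s s≤b c≤t t≤d ac ad bc bd =
    subst (_< q) (ℚ.*-comm t s)
      (edge {t} {a} {b} {s} a≤s s≤b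
        (subst (_< q) (ℚ.*-comm a t) (edge {a} {c} {d} {t} c≤t t≤d ac ad))
        (subst (_< q) (ℚ.*-comm b t) (edge {b} {c} {d} {t} c≤t t≤d bc bd)))
    where
    edge : ∀ {a c d t} → c ≤ t → t ≤ d → a * c < q → a * d < q → a * t < q
    edge {a} c≤t t≤d ac ad with ℚ.≤-total 0ℚ a
    ... | inj₁ 0≤a = ℚ.≤-<-trans (*≤ˡ 0≤a t≤d) ad
    ... | inj₂ a≤0 = ℚ.≤-<-trans (*≤ˡ⁻ a≤0 c≤t) ac

record Box (x y : ℝ) : Set where
  constructor box
  field
    {a b c d} : ℚ
    a<x : L x a
    x<b : U x b
    c<y : L y c
    y<d : U y d

  Below Above : ℚ → Set
  Below q = q < a * c × q < a * d × q < b * c × q < b * d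
  Above q = a * c < q × a * d < q × b * c < q × b * d < q

open Box using (Below; Above)

opaque
  ⊔-closed : ∀ (P : ℚ → Set) {a b} → P a → P b → P (a ℚ.⊔ b)
  ⊔-closed P {a} {b} Pa Pb with ℚ.≤-total a b
  ... | inj₁ a≤b = subst P (sym (ℚ.p≤q⇒p⊔q≡q a≤b)) Pb
  ... | inj₂ b≤a = subst P (sym (ℚ.p≥q⇒p⊔q≡p b≤a)) Pa

opaque
  ⊓-closed : ∀ (P : ℚ → Set) {a b} → P a → P b → P (a ℚ.⊓ b)
  ⊓-closed P {a} {b} Pa Pb with ℚ.≤-total a b
  ... | inj₁ a≤b = subst P (sym (ℚ.p≤q⇒p⊓q≡p a≤b)) Pa
  ... | inj₂ b≤a = subst P (sym (ℚ.p≥q⇒p⊓q≡q b≤a)) Pb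

opaque
  max4 : ∀ a b c d → ∃ λ m → (a ≤ m × b ≤ m × c ≤ m × d ≤ m) ×
    (∀ {q} → a < q → b < q → c < q → d < q → m < q)
  max4 a b c d = (a ℚ.⊔ b) ℚ.⊔ (c ℚ.⊔ d) ,
    (ℚ.≤-trans (ℚ.p≤p⊔q a b) (ℚ.p≤p⊔q (a ℚ.⊔ b) (c ℚ.⊔ d)) ,
     ℚ.≤-trans (ℚ.p≤q⊔p a b) (ℚ.p≤p⊔q (a ℚ.⊔ b) (c ℚ.⊔ d)) ,
     ℚ.≤-trans (ℚ.p≤p⊔q c d) (ℚ.p≤q⊔p (a ℚ.⊔ b) (c ℚ.⊔ d)) ,
     ℚ.≤-trans (ℚ.p≤q⊔p c d) (ℚ.p≤q⊔p (a ℚ.⊔ b) (c ℚ.⊔ d))) ,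
    λ {q} h₁ h₂ h₃ h₄ → ⊔-closed (_< q) {a ℚ.⊔ b} {c ℚ.⊔ d}
      (⊔-closed (_< q) {a} {b} h₁ h₂) (⊔-closed (_< q) {c} {d} h₃ h₄)

opaque
  min4 : ∀ a b c d → ∃ λ m → (m ≤ a × m ≤ b × m ≤ c × m ≤ d) ×
    (∀ {q} → q < a → q < b → q < c → q < d → q < m)
  min4 a b c d = (a ℚ.⊓ b) ℚ.⊓ (c ℚ.⊓ d) ,
    (ℚ.≤-trans (ℚ.p⊓q≤p (a ℚ.⊓ b) (c ℚ.⊓ d)) (ℚ.p⊓q≤p a b) ,
     ℚ.≤-trans (ℚ.p⊓q≤p (a ℚ.⊓ b) (c ℚ.⊓ d)) (ℚ.p⊓q≤q a b) ,
     ℚ.≤-trans (ℚ.p⊓q≤q (a ℚ.⊓ b) (c ℚ.⊓ d)) (ℚ.p⊓q≤p c d) ,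
     ℚ.≤-trans (ℚ.p⊓q≤q (a ℚ.⊓ b) (c ℚ.⊓ d)) (ℚ.p⊓q≤q c d)) ,
    λ {q} h₁ h₂ h₃ h₄ → ⊓-closed (q <_) {a ℚ.⊓ b} {c ℚ.⊓ d}
      (⊓-closed (q <_) {a} {b} h₁ h₂) (⊓-closed (q <_) {c} {d} h₃ h₄)

opaque
  p<p+1 : ∀ p → p < p + 1ℚ
  p<p+1 p = subst (_< p + 1ℚ) (ℚ.+-identityʳ p) (ℚ.+-monoʳ-< p 0<1)

opaque
  p-1<p : ∀ p → p - 1ℚ < p
  p-1<p p = subst (p - 1ℚ <_) (ℚ.+-identityʳ p) (ℚ.+-monoʳ-< p (ℚ.negative⁻¹ (- 1ℚ)))

opaque
  some-box : ∀ x y → Box x y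
  some-box x y = box (proj₂ (L-inhab x)) (proj₂ (U-inhab x))
                     (proj₂ (L-inhab y)) (proj₂ (U-inhab y))

opaque
  boxes-meet : ∀ x y (β γ : Box x y) {q} → Below β q → Above γ q → ⊥
  boxes-meet x y (box {a} {b} {c} {d} La Ub Lc Ud) (box {a′} {b′} {c′} {d′} La′ Ub′ Lc′ Ud′)
    (b₁ , b₂ , b₃ , b₄) (a₁ , a₂ , a₃ , a₄) =
    ℚ.<-asym
      (corners-below (ℚ.p≤p⊔q a a′) (ℚ.<⇒≤ (L<U x Ls Ub)) (ℚ.p≤p⊔q c c′) (ℚ.<⇒≤ (L<U y Lt Ud))
        b₁ b₂ b₃ b₄)
      (corners-above (ℚ.p≤q⊔p a a′) (ℚ.<⇒≤ (L<U x Ls Ub′)) (ℚ.p≤q⊔p c c′) (ℚ.<⇒≤ (L<U y Lt Ud′))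
        a₁ a₂ a₃ a₄)
    where
    Ls : L x (a ℚ.⊔ a′)
    Ls = ⊔-closed (L x) La La′
    Lt : L y (c ℚ.⊔ c′)
    Lt = ⊔-closed (L y) Lc Lc′

opaque
  ≤-sumʳ : ∀ {p q} → 0ℚ ≤ q → p ≤ p + q
  ≤-sumʳ {p} 0≤q = subst (_≤ p + _) (ℚ.+-identityʳ p) (ℚ.+-monoʳ-≤ p 0≤q)

opaque
  abs-≤ : ∀ {s m} → s ≤ m → - s ≤ m → ∣ s ∣ ≤ m
  abs-≤ {s} h₁ h₂ with ℚ.∣p∣≡p∨∣p∣≡-p s
  ... | inj₁ e = subst (_≤ _) (sym e) h₁
  ... | inj₂ e = subst (_≤ _) (sym e) h₂

opaque
  abs-within : ∀ {l u s} → l ≤ s → s ≤ u → ∣ s ∣ ≤ ∣ l ∣ + ∣ u ∣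
  abs-within {l} {u} {s} l≤s s≤u = abs-≤
    (ℚ.≤-trans s≤u (ℚ.≤-trans (x≤∣x∣ u)
      (subst (_≤ ∣ l ∣ + ∣ u ∣) (ℚ.+-identityˡ _) (ℚ.+-monoˡ-≤ ∣ u ∣ (ℚ.0≤∣p∣ l)))))
    (ℚ.≤-trans (ℚ.neg-antimono-≤ l≤s) (ℚ.≤-trans (x≤∣x∣ (- l))
      (ℚ.≤-trans (ℚ.≤-reflexive (ℚ.∣-p∣≡∣p∣ l)) (≤-sumʳ (ℚ.0≤∣p∣ u)))))

opaque
  abs-* : ∀ {s t m n} → ∣ s ∣ ≤ m → ∣ t ∣ ≤ n → s * t ≤ m * n
  abs-* {s} {t} {m} {n} h₁ h₂ = ℚ.≤-trans (x≤∣x∣ (s * t))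
    (ℚ.≤-trans (ℚ.≤-reflexive (ℚ.∣p*q∣≡∣p∣*∣q∣ s t))
      (ℚ.≤-trans (*≤ˡ (ℚ.0≤∣p∣ s) h₂) (*≤ʳ (ℚ.≤-trans (ℚ.0≤∣p∣ t) h₂) h₁)))

_∈[_,_] : ℚ → ℚ → ℚ → Set
s ∈[ l , u ] = l ≤ s × s ≤ u

opaque
  within : ∀ {l u s s′ δ} → u - l ≤ δ → s ∈[ l , u ] → s′ ∈[ l , u ] → ∣ s - s′ ∣ ≤ δ
  within {l} {u} {s} {s′} w (l≤s , s≤u) (l≤s′ , s′≤u) = abs-≤
    (ℚ.≤-trans (ℚ.+-mono-≤ s≤u (ℚ.neg-antimono-≤ l≤s′)) w)
    (ℚ.≤-trans (ℚ.≤-reflexive (solve 2 (λ s s′ → :- (s :- s′) := s′ :- s) refl s s′))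
      (ℚ.≤-trans (ℚ.+-mono-≤ s′≤u (ℚ.neg-antimono-≤ l≤s)) w))

opaque
  product-spread : ∀ {s s′ t t′ m δ} → ∣ s ∣ ≤ m → ∣ t′ ∣ ≤ m → ∣ s - s′ ∣ ≤ δ → ∣ t - t′ ∣ ≤ δ →
    s * t ≤ s′ * t′ + (m * δ + m * δ)
  product-spread {s} {s′} {t} {t′} {m} {δ} hs ht′ hss′ htt′ =
    ℚ.≤-trans (ℚ.≤-reflexive
      (solve 4 (λ s s′ t t′ → s :* t := s′ :* t′ :+ (s :* (t :- t′) :+ t′ :* (s :- s′)))
        refl s s′ t t′))
      (ℚ.+-monoʳ-≤ (s′ * t′) (ℚ.+-mono-≤ (abs-* hs htt′) (abs-* ht′ hss′)))

opaque
  half+half : ∀ p → p * ½ + p * ½ ≡ p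
  half+half p = trans (sym (ℚ.*-distribˡ-+ p ½ ½)) (ℚ.*-identityʳ p)

opaque
  half : ∀ {p} → 0ℚ < p → ∃ λ h → 0ℚ < h × h + h < p
  half {p} 0<p with dense 0<p
  ... | q , 0<q , q<p = q * ½ , 0<* 0<q 0<½ , subst (_< p) (sym (half+half q)) q<p

opaque
  small-width : ∀ {m ε} → 0ℚ < m → 0ℚ < ε → ∃ λ δ → 0ℚ < δ × m * δ + m * δ < ε
  small-width {m} {ε} 0<m 0<ε with half 0<ε
  ... | h , 0<h , 2h<ε with quotient 0<m 0<h
  ...   | δ , 0<δ , mδ≡h = δ , 0<δ , subst (λ z → z + z < ε) (sym mδ≡h) 2h<ε

opaque
  -- The intersection of a narrow enclosing interval with a given one.
  narrow : ∀ z {l u δ} → 0ℚ < δ → L z l → U z u →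
    ∃₂ λ l′ u′ → L z l′ × U z u′ × l ≤ l′ × u′ ≤ u × u′ - l′ ≤ δ
  narrow z {l} {u} 0<δ Ll Uu with approximate z 0<δ
  ... | l′ , u′ , Ll′ , Uu′ , w = l ℚ.⊔ l′ , u ℚ.⊓ u′ ,
    ⊔-closed (L z) Ll Ll′ , ⊓-closed (U z) Uu Uu′ , ℚ.p≤p⊔q l l′ , ℚ.p⊓q≤p u u′ ,
    shrink (ℚ.p⊓q≤q u u′) (ℚ.p≤q⊔p l l′) w
    where
    shrink : ∀ {u l u′ l′ δ} → u′ ≤ u → l ≤ l′ → u - l ≤ δ → u′ - l′ ≤ δ
    shrink {u} {l} {u′} {l′} u′≤u l≤l′ =
      ℚ.≤-trans (ℚ.+-mono-≤ {u′} {u} {(- l′)} {(- l)} u′≤u (ℚ.neg-antimono-≤ {l} {l′} l≤l′))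

opaque
  0≤+ : ∀ {p q} → 0ℚ ≤ p → 0ℚ ≤ q → 0ℚ ≤ p + q
  0≤+ {p} {q} 0≤p 0≤q = ℚ.≤-trans 0≤p (≤-sumʳ 0≤q)

opaque
  common-bound : ∀ a b c d → ∃ λ m → 0ℚ < m × ∣ a ∣ + ∣ b ∣ ≤ m × ∣ c ∣ + ∣ d ∣ ≤ m
  common-bound a b c d = (p + q) + 1ℚ ,
    ℚ.≤-<-trans (0≤+ 0≤p 0≤q) (p<p+1 (p + q)) ,
    ℚ.≤-trans (≤-sumʳ 0≤q) (ℚ.<⇒≤ (p<p+1 (p + q))) ,
    ℚ.≤-trans (subst (_≤ p + q) (ℚ.+-identityˡ q) (ℚ.+-monoˡ-≤ q 0≤p)) (ℚ.<⇒≤ (p<p+1 (p + q)))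
    where
    p : ℚ
    p = ∣ a ∣ + ∣ b ∣
    q : ℚ
    q = ∣ c ∣ + ∣ d ∣
    0≤p : 0ℚ ≤ p
    0≤p = 0≤+ (ℚ.0≤∣p∣ a) (ℚ.0≤∣p∣ b)
    0≤q : 0ℚ ≤ q
    0≤q = 0≤+ (ℚ.0≤∣p∣ c) (ℚ.0≤∣p∣ d)

opaque
  narrow-box : ∀ x y {ε} → 0ℚ < ε → Σ (Box x y) λ β → let open Box β in
    ∃ λ m → (m ≤ a * c × m ≤ a * d × m ≤ b * c × m ≤ b * d) ×
            (a * c < m + ε × a * d < m + ε × b * c < m + ε × b * d < m + ε)
  narrow-box x y {ε} 0<ε with some-box x y
  ... | box {a₀} {b₀} {c₀} {d₀} La₀ Ub₀ Lc₀ Ud₀ with common-bound a₀ b₀ c₀ d₀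
  ... | M , 0<M , ab≤M , cd≤M with small-width 0<M 0<ε
  ... | δ , 0<δ , 2Mδ<ε with narrow x 0<δ La₀ Ub₀ | narrow y 0<δ Lc₀ Ud₀
  ... | a , b , La , Ub , a₀≤a , b≤b₀ , w | c , d , Lc , Ud , c₀≤c , d≤d₀ , w′
    with min4 (a * c) (a * d) (b * c) (b * d)
  ... | m , lower , greatest = box La Ub Lc Ud , m , lower , (bound {a} {c} a∈ c∈ , bound {a} {d} a∈ d∈ , bound {b} {c} b∈ c∈ , bound {b} {d} b∈ d∈)
    where
    a≤b : a ≤ b
    a≤b = ℚ.<⇒≤ (L<U x La Ub)
    c≤d : c ≤ d
    c≤d = ℚ.<⇒≤ (L<U y Lc Ud)
    a∈ : a ∈[ a , b ]
    a∈ = ℚ.≤-refl , a≤b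
    b∈ : b ∈[ a , b ]
    b∈ = a≤b , ℚ.≤-refl
    c∈ : c ∈[ c , d ]
    c∈ = ℚ.≤-refl , c≤d
    d∈ : d ∈[ c , d ]
    d∈ = c≤d , ℚ.≤-refl
    abs-x : ∀ {s} → s ∈[ a , b ] → ∣ s ∣ ≤ M
    abs-x (h , k) = ℚ.≤-trans (abs-within (ℚ.≤-trans a₀≤a h) (ℚ.≤-trans k b≤b₀)) ab≤M
    abs-y : ∀ {t} → t ∈[ c , d ] → ∣ t ∣ ≤ M
    abs-y (h , k) = ℚ.≤-trans (abs-within (ℚ.≤-trans c₀≤c h) (ℚ.≤-trans k d≤d₀)) cd≤M
    spread : ∀ {s s′ t t′} → s ∈[ a , b ] → s′ ∈[ a , b ] → t ∈[ c , d ] → t′ ∈[ c , d ] →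
      s * t < s′ * t′ + ε
    spread {s} {s′} {t} {t′} s∈ s′∈ t∈ t′∈ = ℚ.≤-<-trans
      (product-spread {s} {s′} {t} {t′} (abs-x {s} s∈) (abs-y {t′} t′∈) (within {a} {b} w s∈ s′∈) (within {c} {d} w′ t∈ t′∈))
      (ℚ.+-monoʳ-< (s′ * t′) 2Mδ<ε)
    bound : ∀ {s t} → s ∈[ a , b ] → t ∈[ c , d ] → s * t < m + ε
    bound {s} {t} s∈ t∈ = subst₂ _<_ (cancel (s * t)) refl (ℚ.+-monoˡ-< ε
      (greatest (below (spread {s} {a} {t} {c} s∈ a∈ t∈ c∈)) (below (spread {s} {a} {t} {d} s∈ a∈ t∈ d∈))
                (below (spread {s} {b} {t} {c} s∈ b∈ t∈ c∈)) (below (spread {s} {b} {t} {d} s∈ b∈ t∈ d∈))))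
      where
      cancel : ∀ z → (z - ε) + ε ≡ z
      cancel z = solve 2 (λ z e → (z :- e) :+ e := z) refl z ε
      below : ∀ {z} → s * t < z + ε → s * t - ε < z
      below {z} h = subst (s * t - ε <_) (solve 2 (λ z e → (z :+ e) :- e := z) refl z ε)
        (ℚ.+-monoˡ-< (- ε) h)

opaque
  below-round : ∀ {x y p} (β : Box x y) → Below β p → ∃ λ q → p < q × Below β q
  below-round (box {a} {b} {c} {d} _ _ _ _) (h₁ , h₂ , h₃ , h₄)
    with min4 (a * c) (a * d) (b * c) (b * d)
  ... | m , (k₁ , k₂ , k₃ , k₄) , greatest with dense (greatest h₁ h₂ h₃ h₄)
  ... | q , p<q , q<m = q , p<q ,
    ℚ.<-≤-trans q<m k₁ , ℚ.<-≤-trans q<m k₂ , ℚ.<-≤-trans q<m k₃ , ℚ.<-≤-trans q<m k₄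

opaque
  above-round : ∀ {x y q} (β : Box x y) → Above β q → ∃ λ p → p < q × Above β p
  above-round (box {a} {b} {c} {d} _ _ _ _) (h₁ , h₂ , h₃ , h₄)
    with max4 (a * c) (a * d) (b * c) (b * d)
  ... | m , (k₁ , k₂ , k₃ , k₄) , least with dense (least h₁ h₂ h₃ h₄)
  ... | p , m<p , p<q = p , p<q ,
    ℚ.≤-<-trans k₁ m<p , ℚ.≤-<-trans k₂ m<p , ℚ.≤-<-trans k₃ m<p , ℚ.≤-<-trans k₄ m<p

infixl 7 _*ᴿ_

_*ᴿ_ : ℝ → ℝ → ℝ
L (x *ᴿ y) q = Σ (Box x y) λ β → Below β q
U (x *ᴿ y) q = Σ (Box x y) λ β → Above β q
L-inhab (x *ᴿ y) with some-box x y
... | β@(box {a} {b} {c} {d} _ _ _ _) with min4 (a * c) (a * d) (b * c) (b * d)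
...   | m , (h₁ , h₂ , h₃ , h₄) , _ = m - 1ℚ , β ,
  ℚ.<-≤-trans (p-1<p m) h₁ , ℚ.<-≤-trans (p-1<p m) h₂ ,
  ℚ.<-≤-trans (p-1<p m) h₃ , ℚ.<-≤-trans (p-1<p m) h₄
U-inhab (x *ᴿ y) with some-box x y
... | β@(box {a} {b} {c} {d} _ _ _ _) with max4 (a * c) (a * d) (b * c) (b * d)
...   | m , (h₁ , h₂ , h₃ , h₄) , _ = m + 1ℚ , β ,
  ℚ.≤-<-trans h₁ (p<p+1 m) , ℚ.≤-<-trans h₂ (p<p+1 m) ,
  ℚ.≤-<-trans h₃ (p<p+1 m) , ℚ.≤-<-trans h₄ (p<p+1 m)
L-down (x *ᴿ y) p<q (β , h₁ , h₂ , h₃ , h₄) = β ,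
  ℚ.<-trans p<q h₁ , ℚ.<-trans p<q h₂ , ℚ.<-trans p<q h₃ , ℚ.<-trans p<q h₄
L-round (x *ᴿ y) (β , below) with below-round {x} {y} β below
... | q , p<q , below′ = q , p<q , β , below′
U-up (x *ᴿ y) p<q (β , h₁ , h₂ , h₃ , h₄) = β ,
  ℚ.<-trans h₁ p<q , ℚ.<-trans h₂ p<q , ℚ.<-trans h₃ p<q , ℚ.<-trans h₄ p<q
U-round (x *ᴿ y) (β , above) with above-round {x} {y} β above
... | p , p<q , above′ = p , p<q , β , above′
disjoint (x *ᴿ y) (β , below) (γ , above) = boxes-meet x y β γ below above
located (x *ᴿ y) {p} {q} p<q with narrow-box x y (0<- p<q)
... | β , m , (l₁ , l₂ , l₃ , l₄) , (u₁ , u₂ , u₃ , u₄) with <-cases p m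
...   | inj₁ p<m = inj₁ (β , ℚ.<-≤-trans p<m l₁ , ℚ.<-≤-trans p<m l₂ ,
                             ℚ.<-≤-trans p<m l₃ , ℚ.<-≤-trans p<m l₄)
...   | inj₂ m≤p = inj₂ (β , ℚ.<-≤-trans u₁ m+ε≤q , ℚ.<-≤-trans u₂ m+ε≤q ,
                             ℚ.<-≤-trans u₃ m+ε≤q , ℚ.<-≤-trans u₄ m+ε≤q)
  where
  m+ε≤q : m + (q - p) ≤ q
  m+ε≤q = subst (m + (q - p) ≤_) (solve 2 (λ p q → p :+ (q :- p) := q) refl p q)
    (ℚ.+-monoˡ-≤ (q - p) m≤p)

instance
  *-positive : ∀ {x y} {{_ : Positive x}} {{_ : Positive y}} → Positive (x *ᴿ y)
  *-positive {x} {y} {{positive 0<x}} {{positive 0<y}}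
    with L-round x 0<x | L-round y 0<y | U-inhab x | U-inhab y
  ... | a , 0<a , La | c , 0<c , Lc | b , Ub | d , Ud = positive
    (box La Ub Lc Ud , 0<* 0<a 0<c , 0<* 0<a 0<d , 0<* 0<b 0<c , 0<* 0<b 0<d)
    where
    0<b = ℚ.<-trans 0<a (L<U x La Ub)
    0<d = ℚ.<-trans 0<c (L<U y Lc Ud)

infix 8 _⁻¹

_⁻¹ : (x : ℝ) {{_ : Positive x}} → ℝ
L (x ⁻¹) q = ∃ λ s → U x s × q * s < 1ℚ
U (x ⁻¹) q = ∃ λ s → L x s × 0ℚ < s × 1ℚ < q * s
L-inhab (x ⁻¹) with U-inhab x
... | s , Us = 0ℚ , s , Us , subst (_< 1ℚ) (sym (ℚ.*-zeroˡ s)) 0<1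
U-inhab (_⁻¹ x {{positive 0<x}}) with L-round x 0<x
... | s , 0<s , Ls with quotient 0<s (ℚ.<-trans 0<1 (p<p+1 1ℚ))
...   | i , 0<i , si≡2 = i , s , Ls , 0<s ,
  subst (1ℚ <_) (trans (sym si≡2) (ℚ.*-comm s i)) (p<p+1 1ℚ)
L-down (_⁻¹ x {{positive 0<x}}) p<q (s , Us , qs<1) =
  s , Us , ℚ.<-trans (*<ʳ (L<U x 0<x Us) p<q) qs<1
L-round (_⁻¹ x {{positive 0<x}}) {q} (s , Us , qs<1) with dense qs<1
... | t , qs<t , t<1 with inverse (L<U x 0<x Us)
...   | i , 0<i , si≡1 = t * i ,
  *<-cancelʳ (L<U x 0<x Us) (subst (q * s <_) (sym tis≡t) qs<t) ,
  s , Us , subst (_< 1ℚ) (sym tis≡t) t<1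
  where
  tis≡t : t * i * s ≡ t
  tis≡t = trans (ℚ.*-assoc t i s) (trans (cong (t *_) (trans (ℚ.*-comm i s) si≡1)) (ℚ.*-identityʳ t))
U-up (x ⁻¹) p<q (s , Ls , 0<s , 1<ps) = s , Ls , 0<s , ℚ.<-trans 1<ps (*<ʳ 0<s p<q)
U-round (x ⁻¹) {q} (s , Ls , 0<s , 1<qs) with dense 1<qs
... | t , 1<t , t<qs with inverse 0<s
...   | i , 0<i , si≡1 = t * i ,
  *<-cancelʳ 0<s (subst (_< q * s) (sym tis≡t) t<qs) ,
  s , Ls , 0<s , subst (1ℚ <_) (sym tis≡t) 1<t
  where
  tis≡t : t * i * s ≡ t
  tis≡t = trans (ℚ.*-assoc t i s) (trans (cong (t *_) (trans (ℚ.*-comm i s) si≡1)) (ℚ.*-identityʳ t))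
disjoint (x ⁻¹) {q} (s , Us , qs<1) (s′ , Ls′ , 0<s′ , 1<qs′) =
  ℚ.<-asym (ℚ.<-trans 1<qs′ (*<ˡ 0<q (L<U x Ls′ Us))) qs<1
  where
  0<q : 0ℚ < q
  0<q = *<-cancelʳ 0<s′ (subst (_< q * s′) (sym (ℚ.*-zeroˡ s′)) (ℚ.<-trans 0<1 1<qs′))
located (x ⁻¹) {q} {q′} q<q′ with <-cases 0ℚ q
... | inj₂ q≤0 with U-inhab x
...   | s , Us with <-cases 0ℚ s
...     | inj₁ 0<s = inj₁ (s , Us , ℚ.≤-<-trans (*≤ʳ (ℚ.<⇒≤ 0<s) q≤0)
                            (subst (_< 1ℚ) (sym (ℚ.*-zeroˡ s)) 0<1))
located (_⁻¹ x {{positive 0<x}}) {q} {q′} q<q′ | inj₂ q≤0 | s , Us | inj₂ s≤0 =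
  ⊥-elim (ℚ.<-irrefl refl (ℚ.<-≤-trans (L<U x 0<x Us) s≤0))
located (x ⁻¹) {q} {q′} q<q′ | inj₁ 0<q
  with inverse 0<q | inverse (ℚ.<-trans 0<q q<q′)
... | i , 0<i , qi≡1 | i′ , 0<i′ , q′i′≡1 with located x i′<i
  where
  i′<i : i′ < i
  i′<i = *<-cancelʳ {q} 0<q (subst₂ _<_ (ℚ.*-comm q i′) (trans (sym qi≡1) (ℚ.*-comm q i))
    (subst (q * i′ <_) q′i′≡1 (*<ʳ 0<i′ q<q′)))
...   | inj₁ Li′ with L-round x Li′
...     | s , i′<s , Ls = inj₂ (s , Ls , ℚ.<-trans 0<i′ i′<s ,
  subst (_< q′ * s) q′i′≡1 (*<ˡ (ℚ.<-trans 0<q q<q′) i′<s))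
located (x ⁻¹) {q} {q′} q<q′ | inj₁ 0<q | i , 0<i , qi≡1 | i′ , 0<i′ , q′i′≡1 | inj₂ Ui
  with U-round x Ui
... | s , s<i , Us = inj₁ (s , Us , subst (q * s <_) qi≡1 (*<ˡ 0<q s<i))

infixl 7 _÷ᴿ_

_÷ᴿ_ : (x y : ℝ) {{_ : Positive y}} → ℝ
x ÷ᴿ y = x *ᴿ y ⁻¹

base : ℕ → ℚ → ℚ
base k p = 1ℚ + p * recip k

-- As n grows through the values with 1 ± p/n > 0, (1 + p/n)ⁿ increases and
-- (1 - p/n)⁻ⁿ decreases, both to eᵖ, strictly so unless p = 0, when both are
-- constantly 1.  Hence q < eᵖ iff q < (1 + p/n)ⁿ for some such n, and eᵖ < q
-- iff 1 < q (1 - p/n)ⁿ for some such n.  Here n = k + 1.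

infix 4 _<exp_ _>exp_

_<exp_ : ℚ → ℚ → Set
q <exp p = ∃ λ k → 0ℚ < base k p × q < base k p ^ suc k

_>exp_ : ℚ → ℚ → Set
q >exp p = ∃ λ k → 0ℚ < base k (- p) × 1ℚ < q * base k (- p) ^ suc k

opaque
  recip-product : ∀ k l → recip (l ℕ.+ k ℕ.* suc l) * ι (suc l) ≡ recip k
  recip-product k l = trans (sym (ℚ.*-identityʳ _)) (trans (cong (r * b *_) (sym (ι-recip k)))
    (trans (solve 4 (λ r b a s → r :* b :* (a :* s) := (a :* b :* r) :* s) refl r b a (recip k))
    (trans (cong (λ z → z * r * recip k) (sym (ι-* (suc k) (suc l))))
    (trans (cong (_* recip k) (ι-recip (l ℕ.+ k ℕ.* suc l))) (ℚ.*-identityˡ _)))))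
    where
    r a b : ℚ
    r = recip (l ℕ.+ k ℕ.* suc l)
    a = ι (suc k)
    b = ι (suc l)

opaque
  base-mono : ∀ k {p q} → p ≤ q → base k p ≤ base k q
  base-mono k p≤q = ℚ.+-monoʳ-≤ 1ℚ (*≤ʳ (ℚ.<⇒≤ (0<recip k)) p≤q)

opaque
  base-pos : ∀ k {p} → (- p) * recip k < 1ℚ → 0ℚ < base k p
  base-pos k {p} h = subst (0ℚ <_)
    (solve 2 (λ p r → con 1ℚ :- (:- p) :* r := con 1ℚ :+ p :* r) refl p (recip k)) (0<- h)

opaque
  base-pos⁻ : ∀ k {p} → p * recip k < 1ℚ → 0ℚ < base k (- p)
  base-pos⁻ k {p} h = base-pos k {(- p)}
    (subst (λ z → z * recip k < 1ℚ) (solve 1 (λ p → p := :- (:- p)) refl p) h)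

opaque
  base-expand : ∀ k l p → base k p ≡ 1ℚ + ι (suc l) * (p * recip (l ℕ.+ k ℕ.* suc l))
  base-expand k l p = cong (1ℚ +_) (trans (cong (p *_) (sym (recip-product k l)))
    (solve 3 (λ p r b → p :* (r :* b) := b :* (p :* r)) refl p (recip (l ℕ.+ k ℕ.* suc l)) (ι (suc l))))

opaque
  base-pos-lift : ∀ k l {p} → 0ℚ < base k p → 0ℚ < base (l ℕ.+ k ℕ.* suc l) p
  base-pos-lift k l {p} 0<b = go (p * recip (l ℕ.+ k ℕ.* suc l))
    (subst (0ℚ <_) (trans (base-expand k l p)
      (cong (λ m → 1ℚ + m * (p * recip (l ℕ.+ k ℕ.* suc l))) (ι-suc l))) 0<b)
    where
    go : ∀ y → 0ℚ < 1ℚ + (1ℚ + ι l) * y → 0ℚ < 1ℚ + y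
    go y h with ℚ.≤-total 0ℚ y
    ... | inj₁ 0≤y = ℚ.<-≤-trans 0<1 (≤-sumʳ 0≤y)
    ... | inj₂ y≤0 = ℚ.<-≤-trans h (-≤⁻¹ (subst (0ℚ ≤_)
      (solve 2 (λ l y → l :* (:- y) := (con 1ℚ :+ y) :- (con 1ℚ :+ (con 1ℚ :+ l) :* y)) refl (ι l) y)
      (0≤* (0≤ι l) (ℚ.neg-antimono-≤ y≤0))))

opaque
  power-lift : ∀ k l {p} → 0ℚ < base k p →
    base k p ^ suc k ≤ base (l ℕ.+ k ℕ.* suc l) p ^ suc (l ℕ.+ k ℕ.* suc l)
  power-lift k l {p} 0<b = ℚ.≤-trans
    (^-mono (suc k) 0<b (subst (_≤ base kl p ^ suc l) (sym (base-expand k l p))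
      (bernoulli (suc l) (base-pos-lift k l {p} 0<b))))
    (ℚ.≤-reflexive (trans (^-assocʳ (base kl p) (suc l) (suc k))
      (cong (base kl p ^_) (ℕ.*-comm (suc l) (suc k)))))
    where
    kl : ℕ
    kl = l ℕ.+ k ℕ.* suc l

opaque
  powers-below-1 : ∀ k {p} → 0ℚ < base k p → 0ℚ < base k (- p) →
    base k p ^ suc k * base k (- p) ^ suc k ≤ 1ℚ
  powers-below-1 k {p} 0<b 0<b⁻ = subst₂ _≤_
    (^-distrib-* (base k p) (base k (- p)) (suc k)) (1^n≡1 (suc k))
    (^-mono {base k p * base k (- p)} {1ℚ} (suc k) (0<* 0<b 0<b⁻)
      (-≤⁻¹ {base k p * base k (- p)} {1ℚ} (subst (0ℚ ≤_)
        (solve 2 (λ p r → (p :* r) :* (p :* r) :=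
          con 1ℚ :- (con 1ℚ :+ p :* r) :* (con 1ℚ :+ (:- p) :* r)) refl p (recip k))
        (0≤square (p * recip k)))))

opaque
  exp-upper : ∀ k l {p} → 0ℚ < base k p → 0ℚ < base l (- p) →
    base k p ^ suc k * base l (- p) ^ suc l ≤ 1ℚ
  exp-upper k l {p} 0<b 0<b⁻ = ℚ.≤-trans
    (ℚ.≤-trans
      (*≤ʳ {base l (- p) ^ suc l} (ℚ.<⇒≤ (^-pos {base l (- p)} (suc l) 0<b⁻)) (power-lift k l {p} 0<b))
      (*≤ˡ {base kl p ^ suc kl} (ℚ.<⇒≤ (^-pos {base kl p} (suc kl) 0<B)) lift⁻))
    (powers-below-1 kl {p} 0<B 0<B⁻)
    where
    kl : ℕ
    kl = l ℕ.+ k ℕ.* suc l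
    swap : k ℕ.+ l ℕ.* suc k ≡ kl
    swap = ℕ.suc-injective (ℕ.*-comm (suc l) (suc k))
    0<B : 0ℚ < base kl p
    0<B = base-pos-lift k l {p} 0<b
    0<B⁻ : 0ℚ < base kl (- p)
    0<B⁻ = subst (λ n → 0ℚ < base n (- p)) swap (base-pos-lift l k {(- p)} 0<b⁻)
    lift⁻ : base l (- p) ^ suc l ≤ base kl (- p) ^ suc kl
    lift⁻ = subst (λ n → base l (- p) ^ suc l ≤ base n (- p) ^ suc n) swap
      (power-lift l k {(- p)} 0<b⁻)

opaque
  exp-lower : ∀ k {p q} → 0ℚ < base k p → 0ℚ < base k (- q) →
    1ℚ + ((p - q) - p * q * recip k) ≤ base k p ^ suc k * base k (- q) ^ suc k
  exp-lower k {p} {q} 0<b 0<b⁻ = subst₂ _≤_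
    (cong (λ z → 1ℚ + z) (trans
      (solve 4 (λ p q r n → n :* ((p :- q) :* r :- p :* q :* r :* r) :=
          (n :* r) :* ((p :- q) :- p :* q :* r)) refl p q (recip k) (ι (suc k)))
      (trans (cong (_* ((p - q) - p * q * recip k)) (ι-recip k)) (ℚ.*-identityˡ ((p - q) - p * q * recip k)))))
    (trans (cong (_^ suc k) (sym product)) (^-distrib-* (base k p) (base k (- q)) (suc k)))
    (bernoulli (suc k) {(p - q) * recip k - p * q * recip k * recip k}
      (subst (0ℚ <_) product (0<* 0<b 0<b⁻)))
    where
    product : base k p * base k (- q) ≡ 1ℚ + ((p - q) * recip k - p * q * recip k * recip k)
    product = solve 3 (λ p q r → (con 1ℚ :+ p :* r) :* (con 1ℚ :+ (:- q) :* r) :=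
      con 1ℚ :+ ((p :- q) :* r :- p :* q :* r :* r)) refl p q (recip k)

opaque
  recip-small₃ : ∀ a b c {η} → 0ℚ < η →
    ∃ λ k → a * recip k < 1ℚ × b * recip k < 1ℚ × c * recip k < η
  recip-small₃ a b c {η} 0<η with max4 a b c c
  ... | m , (a≤m , b≤m , c≤m , _) , _ with recip-small m (⊓-closed (0ℚ <_) 0<1 0<η)
  ... | k , h = k , below a≤m (ℚ.p⊓q≤p 1ℚ η) , below b≤m (ℚ.p⊓q≤p 1ℚ η) , below c≤m (ℚ.p⊓q≤q 1ℚ η)
    where
    below : ∀ {x y} → x ≤ m → 1ℚ ℚ.⊓ η ≤ y → x * recip k < y
    below x≤m δ≤y = ℚ.<-≤-trans (ℚ.≤-<-trans (*≤ʳ (ℚ.<⇒≤ (0<recip k)) x≤m) h) δ≤y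

opaque
  <exp-exists : ∀ p → ∃ λ k → 0ℚ < base k p
  <exp-exists p with recip-small (- p) 0<1
  ... | k , h = k , base-pos k {p} h

opaque
  perturb : ∀ k {p q} → 0ℚ < base k p → q < base k p ^ suc k →
    ∃ λ p′ → p′ < p × 0ℚ < base k p′ × q < base k p′ ^ suc k
  perturb k {p} {q} 0<b q<b^n with dense (⊔-closed (_< base k p ^ suc k) q<b^n (^-pos (suc k) 0<b))
  ... | m , q⊔0<m , m<b^n with quotient (0<* (0<ι (suc k)) (^-pos (suc k) 0<b)) (0<- m<b^n)
  ... | t , 0<t , nEt≡E-m = p - ι (suc k) * (t * base k p) , p′<p ,
    subst (0ℚ <_) (sym base′) (0<* 0<1-t 0<b) ,
    ℚ.<-≤-trans (ℚ.≤-<-trans (ℚ.p≤p⊔q q 0ℚ) q⊔0<m) m≤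
    where
    E : ℚ
    E = base k p ^ suc k
    p′<p : p - ι (suc k) * (t * base k p) < p
    p′<p = -<⁻¹ (subst (0ℚ <_)
      (solve 2 (λ p d → d := p :- (p :- d)) refl p (ι (suc k) * (t * base k p)))
      (0<* (0<ι (suc k)) (0<* 0<t 0<b)))
    base′ : base k (p - ι (suc k) * (t * base k p)) ≡ (1ℚ + - t) * base k p
    base′ = trans (solve 5 (λ p n t b r → con 1ℚ :+ (p :- n :* (t :* b)) :* r :=
          (con 1ℚ :+ p :* r) :- (n :* r) :* (t :* b)) refl p (ι (suc k)) t (base k p) (recip k))
      (trans (cong (λ z → base k p - z * (t * base k p)) (ι-recip k))
        (solve 2 (λ b t → b :- con 1ℚ :* (t :* b) := (con 1ℚ :+ :- t) :* b) refl (base k p) t))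
    Em≡ : (1ℚ + ι (suc k) * (- t)) * E ≡ m
    Em≡ = trans (solve 3 (λ n t e → (con 1ℚ :+ n :* (:- t)) :* e := e :- (n :* e) :* t) refl (ι (suc k)) t E)
      (trans (cong (λ z → E - z) nEt≡E-m) (solve 2 (λ e m → e :- (e :- m) := m) refl E m))
    0<m : 0ℚ < m
    0<m = ℚ.≤-<-trans (ℚ.p≤q⊔p q 0ℚ) q⊔0<m
    -- 1 - t exceeds 1 - nt = m/E > 0
    0<1-t : 0ℚ < 1ℚ + - t
    0<1-t = ℚ.<-≤-trans
      (*<-cancelʳ {E} (^-pos (suc k) 0<b) (subst₂ _<_ (sym (ℚ.*-zeroˡ E)) (sym Em≡) 0<m))
      (-≤⁻¹ (subst (0ℚ ≤_)
        (trans (solve 2 (λ n t → n :* t := (con 1ℚ :+ :- t) :- (con 1ℚ :+ (con 1ℚ :+ n) :* (:- t))) refl (ι k) t)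
          (cong (λ n → (1ℚ + - t) - (1ℚ + n * (- t))) (sym (ι-suc k))))
        (0≤* (0≤ι k) (ℚ.<⇒≤ 0<t))))
    m≤ : m ≤ base k (p - ι (suc k) * (t * base k p)) ^ suc k
    m≤ = subst₂ _≤_ Em≡
      (trans (sym (^-distrib-* (1ℚ + - t) (base k p) (suc k))) (cong (_^ suc k) (sym base′)))
      (*≤ʳ (ℚ.<⇒≤ (^-pos (suc k) 0<b)) (bernoulli (suc k) 0<1-t))

opaque
  <exp-mono : ∀ {p p′ q} → p ≤ p′ → q <exp p → q <exp p′
  <exp-mono p≤p′ (k , 0<b , h) = k , ℚ.<-≤-trans 0<b (base-mono k p≤p′) ,
    ℚ.<-≤-trans h (^-mono (suc k) 0<b (base-mono k p≤p′))

opaque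
  <exp-round : ∀ {p q} → q <exp p → ∃ λ p′ → p′ < p × q <exp p′
  <exp-round {p} {q} (k , 0<b , h) with perturb k {p} {q} 0<b h
  ... | p′ , p′<p , 0<b′ , h′ = p′ , p′<p , k , 0<b′ , h′

opaque
  >exp-pos : ∀ {p q} → q >exp p → 0ℚ < q
  >exp-pos {p} {q} (k , 0<b , h) = *<-cancelʳ {base k (- p) ^ suc k} {0ℚ} {q}
    (^-pos {base k (- p)} (suc k) 0<b)
    (subst (_< q * base k (- p) ^ suc k) (sym (ℚ.*-zeroˡ (base k (- p) ^ suc k))) (ℚ.<-trans 0<1 h))

opaque
  >exp-mono : ∀ {p p′ q} → p ≤ p′ → q >exp p′ → q >exp p
  >exp-mono {p} {p′} {q} p≤p′ e@(k , 0<b , h) = k ,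
    ℚ.<-≤-trans 0<b b≤ ,
    ℚ.<-≤-trans h (*≤ˡ {q} (ℚ.<⇒≤ (>exp-pos {p′} e)) (^-mono {base k (- p′)} {base k (- p)} (suc k) 0<b b≤))
    where
    b≤ : base k (- p′) ≤ base k (- p)
    b≤ = base-mono k (ℚ.neg-antimono-≤ p≤p′)

opaque
  >exp-round : ∀ {p q} → q >exp p → ∃ λ p′ → p < p′ × q >exp p′
  >exp-round {p} {q} e@(k , 0<b , h) with inverse (>exp-pos {p} {q} e)
  ... | i , 0<i , qi≡1
    with perturb k { - p} {i} 0<b (*<-cancelʳ 0<q (subst₂ _<_ (trans (sym qi≡1) (ℚ.*-comm q i)) (ℚ.*-comm q _) h))
    where
    0<q : 0ℚ < q
    0<q = >exp-pos {p} {q} e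
  ... | p′ , p′<-p , 0<b′ , h′ = - p′ ,
    subst (_< - p′) (ℚ-neg-neg p) (ℚ.neg-antimono-< p′<-p) ,
    k , subst (λ z → 0ℚ < base k z) (sym (ℚ-neg-neg p′)) 0<b′ ,
    subst₂ _<_ qi≡1 (cong (λ z → q * base k z ^ suc k) (sym (ℚ-neg-neg p′)))
      (*<ˡ (>exp-pos {p} {q} e) h′)
    where
    ℚ-neg-neg : ∀ z → - (- z) ≡ z
    ℚ-neg-neg z = solve 1 (λ z → :- (:- z) := z) refl z

opaque
  >exp-up : ∀ {p q q′} → q < q′ → q >exp p → q′ >exp p
  >exp-up q<q′ (k , 0<b , h) = k , 0<b , ℚ.<-trans h (*<ʳ (^-pos (suc k) 0<b) q<q′)

opaque
  scale-dense : ∀ {d q} → 0ℚ < d → 1ℚ < q * d → ∃ λ q′ → q′ < q × 1ℚ < q′ * d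
  scale-dense {d} {q} 0<d h with dense h
  ... | t , 1<t , t<qd with quotient 0<d (ℚ.<-trans 0<1 1<t)
  ... | q′ , 0<q′ , dq′≡t = q′ ,
    *<-cancelʳ {d} {q′} {q} 0<d (subst (_< q * d) (sym q′d≡t) t<qd) ,
    subst (1ℚ <_) (sym q′d≡t) 1<t
    where
    q′d≡t : q′ * d ≡ t
    q′d≡t = trans (ℚ.*-comm q′ d) dq′≡t

opaque
  >exp-dense : ∀ {p q} → q >exp p → ∃ λ q′ → q′ < q × q′ >exp p
  >exp-dense {p} {q} (k , 0<b , h)
    with scale-dense {base k (- p) ^ suc k} {q} (^-pos {base k (- p)} (suc k) 0<b) h
  ... | q′ , q′<q , h′ = q′ , q′<q , k , 0<b , h′

opaque
  exp-disjoint : ∀ {p q} → q <exp p → q >exp p → ⊥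
  exp-disjoint {p} {q} (k , 0<b , h) (l , 0<b⁻ , h⁻) = ℚ.<-irrefl refl
    (ℚ.<-≤-trans (ℚ.<-trans h⁻ (*<ʳ (^-pos (suc l) 0<b⁻) h)) (exp-upper k l {p} 0<b 0<b⁻))

opaque
  <exp-dense : ∀ {p q} → q <exp p → ∃ λ q′ → q < q′ × q′ <exp p
  <exp-dense (k , 0<b , h) with dense h
  ... | q′ , q<q′ , h′ = q′ , q<q′ , k , 0<b , h′

opaque
  <exp-down : ∀ {p q q′} → q < q′ → q′ <exp p → q <exp p
  <exp-down q<q′ (k , 0<b , h) = k , 0<b , ℚ.<-trans q<q′ h

opaque
  ≤0⇒<exp : ∀ p {q} → q ≤ 0ℚ → q <exp p
  ≤0⇒<exp p q≤0 with <exp-exists p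
  ... | k , 0<b = k , 0<b , ℚ.≤-<-trans q≤0 (^-pos {base k p} (suc k) 0<b)

opaque
  >exp-exists : ∀ p → ∃ λ q → q >exp p
  >exp-exists p with recip-small p 0<1
  ... | k , h with quotient {base k (- p) ^ suc k} (^-pos {base k (- p)} (suc k) (base-pos⁻ k {p} h))
                     (ℚ.<-trans 0<1 (p<p+1 1ℚ))
  ... | q , 0<q , dq≡2 = q , k , base-pos⁻ k {p} h ,
    subst (1ℚ <_) (trans (sym dq≡2) (ℚ.*-comm (base k (- p) ^ suc k) q)) (p<p+1 1ℚ)

opaque
  separate : ∀ {q q′ e d γ} → 0ℚ < d → 0ℚ < q → 0ℚ < q′ → q′ * γ ≡ q′ - q →
    1ℚ + - γ < e * d → e ≤ q → 1ℚ < q′ * d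
  separate {q} {q′} {e} {d} {γ} 0<d 0<q 0<q′ q′γ≡q′-q 1-γ<ed e≤q =
    *<-cancelʳ {q} {1ℚ} {q′ * d} 0<q
      (subst₂ _<_ lhs rhs (*<ˡ {q′} {1ℚ + - γ} {q * d} 0<q′
        (ℚ.<-≤-trans 1-γ<ed (*≤ʳ {d} {e} {q} (ℚ.<⇒≤ 0<d) e≤q))))
    where
    lhs : q′ * (1ℚ + - γ) ≡ 1ℚ * q
    lhs = trans (solve 2 (λ q g → q :* (con 1ℚ :+ :- g) := q :- q :* g) refl q′ γ)
      (trans (cong (λ z → q′ - z) q′γ≡q′-q)
        (solve 2 (λ q′ q → q′ :- (q′ :- q) := con 1ℚ :* q) refl q′ q))
    rhs : q′ * (q * d) ≡ q′ * d * q
    rhs = solve 3 (λ q′ q d → q′ :* (q :* d) := q′ :* d :* q) refl q′ q d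

opaque
  lower-estimate : ∀ {p p′ h γ z} → p′ - p ≤ h → z < h → h + h < γ → 1ℚ + - γ < 1ℚ + ((p - p′) - z)
  lower-estimate {p} {p′} {h} {γ} {z} w z<h 2h<γ = ℚ.+-monoʳ-< 1ℚ (subst (- γ <_)
    (solve 3 (λ p p′ z → :- ((p′ :- p) :+ z) := (p :- p′) :- z) refl p p′ z)
    (ℚ.neg-antimono-< {(p′ - p) + z} {γ}
      (ℚ.<-trans (ℚ.+-mono-≤-< {p′ - p} {h} {z} {h} w z<h) 2h<γ)))

opaque
  exp-separate : ∀ {q q′} → 0ℚ < q → q < q′ →
    ∃ λ h → 0ℚ < h × (∀ p p′ → p′ - p ≤ h → q <exp p ⊎ q′ >exp p′)
  exp-separate {q} {q′} 0<q q<q′ with quotient (ℚ.<-trans 0<q q<q′) (0<- q<q′)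
  ... | γ , 0<γ , q′γ≡q′-q with half 0<γ
  ... | h , 0<h , 2h<γ = h , 0<h , go
    where
    go : ∀ p p′ → p′ - p ≤ h → q <exp p ⊎ q′ >exp p′
    go p p′ w with recip-small₃ (- p) p′ (p * p′) 0<h
    ... | k , k₁ , k₂ , k₃ with <-cases q (base k p ^ suc k)
    ... | inj₁ q<E = inj₁ (k , base-pos k {p} k₁ , q<E)
    ... | inj₂ E≤q = inj₂ (k , base-pos⁻ k {p′} k₂ ,
      separate {q} {q′} {base k p ^ suc k} {base k (- p′) ^ suc k} {γ}
        (^-pos {base k (- p′)} (suc k) (base-pos⁻ k {p′} k₂)) 0<q (ℚ.<-trans 0<q q<q′) q′γ≡q′-q
        (ℚ.<-≤-trans (lower-estimate {p} {p′} {h} {γ} {p * p′ * recip k} w k₃ 2h<γ)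
          (exp-lower k {p} {p′} (base-pos k {p} k₁) (base-pos⁻ k {p′} k₂)))
        E≤q)

exp : ℝ → ℝ
L (exp x) q = ∃ λ p → L x p × q <exp p
U (exp x) q = ∃ λ p → U x p × q >exp p
L-inhab (exp x) with L-inhab x
... | p , Lp = 0ℚ , p , Lp , ≤0⇒<exp p ℚ.≤-refl
U-inhab (exp x) with U-inhab x
... | p , Up with >exp-exists p
...   | q , e = q , p , Up , e
L-down (exp x) q<q′ (p , Lp , e) = p , Lp , <exp-down {p} q<q′ e
L-round (exp x) (p , Lp , e) with <exp-dense {p} e
... | q′ , q<q′ , e′ = q′ , q<q′ , p , Lp , e′
U-up (exp x) q<q′ (p , Up , e) = p , Up , >exp-up {p} q<q′ e
U-round (exp x) (p , Up , e) with >exp-dense {p} e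
... | q′ , q′<q , e′ = q′ , q′<q , p , Up , e′
disjoint (exp x) {q} (p , Lp , e) (p′ , Up′ , e′) =
  exp-disjoint {p′} {q} (<exp-mono {p} {p′} {q} (ℚ.<⇒≤ (L<U x Lp Up′)) e) e′
located (exp x) {q} {q′} q<q′ with <-cases 0ℚ q
... | inj₂ q≤0 with L-inhab x
...   | p , Lp = inj₁ (p , Lp , ≤0⇒<exp p q≤0)
located (exp x) {q} {q′} q<q′ | inj₁ 0<q with exp-separate 0<q q<q′
... | h , 0<h , choose with approximate x 0<h
... | p , p′ , Lp , Up′ , w with choose p p′ w
... | inj₁ e = inj₁ (p , Lp , e)
... | inj₂ e = inj₂ (p′ , Up′ , e)

opaque
  unfolding recip

  -- e^(-1/q) < q, since 1 < q (1 + 1/q)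
  log-lower : ∀ {q} → 0ℚ < q → ∃ λ p → q >exp p
  log-lower {q} 0<q with inverse 0<q
  ... | i , 0<i , qi≡1 = - i , 0 ,
    subst (0ℚ <_) (sym base₀) (ℚ.<-trans 0<i (p<p+1 i)) ,
    subst (1ℚ <_) (sym value) (1<1+ q 0<q)
    where
    1<1+ : ∀ z → 0ℚ < z → 1ℚ < z + 1ℚ
    1<1+ z 0<z = subst (_< z + 1ℚ) (ℚ.+-identityˡ 1ℚ) (ℚ.+-monoˡ-< 1ℚ 0<z)
    base₀ : base 0 (- (- i)) ≡ i + 1ℚ
    base₀ = solve 1 (λ i → con 1ℚ :+ (:- (:- i)) :* con 1ℚ := i :+ con 1ℚ) refl i
    value : q * base 0 (- (- i)) ^ 1 ≡ q + 1ℚ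
    value = trans (cong (q *_) (trans (ℚ.*-identityʳ (base 0 (- (- i)))) base₀))
      (trans (ℚ.*-distribˡ-+ q i 1ℚ)
        (trans (cong₂ _+_ qi≡1 (ℚ.*-identityʳ q)) (ℚ.+-comm 1ℚ q)))

opaque
  unfolding recip

  -- q < 1 + q ≤ e^q
  log-upper : ∀ {q} → 0ℚ < q → q <exp q
  log-upper {q} 0<q = 0 ,
    subst (0ℚ <_) (sym base₀) (ℚ.<-trans 0<q (p<p+1 q)) ,
    subst (q <_) (sym (trans (ℚ.*-identityʳ (base 0 q)) base₀)) (p<p+1 q)
    where
    base₀ : base 0 q ≡ q + 1ℚ
    base₀ = solve 1 (λ q → con 1ℚ :+ q :* con 1ℚ := q :+ con 1ℚ) refl q

opaque
  log-separate : ∀ {p p′} → p < p′ → ∃₂ λ a b → a < b ×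
    (∀ {q} → a < q → q >exp p) × (∀ {q} → q < b → q <exp p′)
  log-separate {p} {p′} p<p′ with recip-small₃ (- p′) p (p′ * p) (0<- p<p′)
  ... | k , k₁ , k₂ , k₃ with inverse {base k (- p) ^ suc k} (^-pos {base k (- p)} (suc k) (base-pos⁻ k {p} k₂))
  ... | i , 0<i , Di≡1 = i , base k p′ ^ suc k ,
    i<C (base k p′ ^ suc k) (base k (- p) ^ suc k) 0<D Di≡1 1<CD ,
    (λ {q} i<q → k , base-pos⁻ k {p} k₂ ,
      subst₂ _<_ Di≡1 (ℚ.*-comm (base k (- p) ^ suc k) q)
        (*<ˡ {base k (- p) ^ suc k} {i} {q} 0<D i<q)) ,
    (λ {q} q<C → k , base-pos k {p′} k₁ , q<C)
    where
    0<D : 0ℚ < base k (- p) ^ suc k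
    0<D = ^-pos {base k (- p)} (suc k) (base-pos⁻ k {p} k₂)
    1<CD : 1ℚ < base k p′ ^ suc k * base k (- p) ^ suc k
    1<CD = ℚ.<-≤-trans (above ((p′ - p) - p′ * p * recip k) (0<- k₃))
      (exp-lower k {p′} {p} (base-pos k {p′} k₁) (base-pos⁻ k {p} k₂))
      where
      above : ∀ z → 0ℚ < z → 1ℚ < 1ℚ + z
      above z 0<z = subst (_< 1ℚ + z) (ℚ.+-identityʳ 1ℚ) (ℚ.+-monoʳ-< 1ℚ 0<z)
    i<C : ∀ c d → 0ℚ < d → d * i ≡ 1ℚ → 1ℚ < c * d → i < c
    i<C c d 0<d di≡1 1<cd = *<-cancelʳ {d} {i} {c} 0<d
      (subst (_< c * d) (trans (sym di≡1) (ℚ.*-comm d i)) 1<cd)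

log : (x : ℝ) {{_ : Positive x}} → ℝ
L (log x) p = ∃ λ q → L x q × q >exp p
U (log x) p = ∃ λ q → U x q × q <exp p
L-inhab (log x {{positive 0<x}}) with L-round x 0<x
... | q , 0<q , Lq with log-lower 0<q
...   | p , e = p , q , Lq , e
U-inhab (log x {{positive 0<x}}) with U-inhab x
... | q , Uq = q , q , Uq , log-upper (L<U x 0<x Uq)
L-down (log x) {p} {p′} p<p′ (q , Lq , e) = q , Lq , >exp-mono {p} {p′} {q} (ℚ.<⇒≤ p<p′) e
L-round (log x) {p} (q , Lq , e) with >exp-round {p} {q} e
... | p′ , p<p′ , e′ = p′ , p<p′ , q , Lq , e′
U-up (log x) {p} {p′} p<p′ (q , Uq , e) = q , Uq , <exp-mono {p} {p′} {q} (ℚ.<⇒≤ p<p′) e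
U-round (log x) {p} (q , Uq , e) with <exp-round {p} {q} e
... | p′ , p′<p , e′ = p′ , p′<p , q , Uq , e′
disjoint (log x) {p} (q , Lq , e) (q′ , Uq′ , e′) =
  exp-disjoint {p} {q′} e′ (>exp-up {p} {q} {q′} (L<U x Lq Uq′) e)
located (log x) p<p′ with log-separate p<p′
... | a , b , a<b , low , high with located x a<b
... | inj₁ La with L-round x La
...   | q , a<q , Lq = inj₁ (q , Lq , low a<q)
located (log x) p<p′ | a , b , a<b , low , high | inj₂ Ub with U-round x Ub
... | q , q<b , Uq = inj₂ (q , Uq , high q<b)

infixr 8 _^ᴿ_

_^ᴿ_ : (x : ℝ) {{_ : Positive x}} → ℝ → ℝ
x ^ᴿ y = exp (y *ᴿ log x)

exp-positive : ∀ x → Positive (exp x)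
exp-positive x with L-inhab x
... | p , Lp = positive (p , Lp , ≤0⇒<exp p ℚ.≤-refl)

instance
  ^-positive : ∀ {x y} {{_ : Positive x}} → Positive (x ^ᴿ y)
  ^-positive {x} {y} = exp-positive (y *ᴿ log x)

monomial : ∀ {r} → Vec ℕ r → Vec ℕ r → ℕ
monomial A u = Vec.foldr′ ℕ._*_ 1 (Vec.zipWith ℕ._^_ A u)

MultiplicativelyIndependent : ∀ {r} → Vec ℕ r → Set
MultiplicativelyIndependent A = Injective _≡_ _≡_ (monomial A)

_IsMinOf_ _IsMaxOf_ : ∀ {r} → ℕ → Vec ℕ r → Set
m IsMinOf A = m ∈ A × All (m ℕ.≤_) A
R IsMaxOf A = R ∈ A × All (ℕ._≤ R) A

H : ∀ {r} → Vec ℕ r → ℕ → ℕ → Set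
H A n x = x ℕ.< n × ∃ λ u → monomial A u ≡ x

opaque
  cap-power : ∀ a v N → a ℕ.^ v ≡ 0 ⊎ a ℕ.^ v ℕ.≤ N → a ℕ.^ (v ℕ.⊓ suc N) ≡ a ℕ.^ v
  cap-power a             zero    N h = refl
  cap-power zero          (suc v) N h = refl
  cap-power (suc zero)    v       N h = trans (ℕ.^-zeroˡ (v ℕ.⊓ suc N)) (sym (ℕ.^-zeroˡ v))
  cap-power (suc (suc a)) v       N (inj₁ e) with () ← ℕ.m^n≡0⇒m≡0 (suc (suc a)) v e
  cap-power (suc (suc a)) v       N (inj₂ h) = cong (suc (suc a) ℕ.^_)
    (ℕ.m≤n⇒m⊓n≡m (ℕ.≤-trans (ℕ.<⇒≤ (v<b^v v)) (ℕ.m≤n⇒m≤1+n h)))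
    where
    v<b^v : ∀ v → v ℕ.< suc (suc a) ℕ.^ v
    v<b^v zero    = ℕ.s≤s ℕ.z≤n
    v<b^v (suc v) = ℕ.≤-trans
      (ℕ.≤-trans (ℕ.s≤s (ℕ.s≤s (ℕ.m≤n+m v v)))
        (ℕ.≤-reflexive (cong suc (trans (sym (ℕ.+-suc v v)) (cong (v ℕ.+_) (sym (ℕ.+-identityʳ (suc v))))))))
      (ℕ.*-mono-≤ {2} {suc (suc a)} (ℕ.s≤s (ℕ.s≤s ℕ.z≤n)) (v<b^v v))

opaque
  cap-monomial : ∀ {r} (A u : Vec ℕ r) N → monomial A u ℕ.≤ N →
    monomial A (Vec.map (ℕ._⊓ suc N) u) ≡ monomial A u
  cap-monomial []      []      N h = refl
  cap-monomial (a ∷ A) (v ∷ u) N h with a ℕ.^ v in eq | monomial A u in eq′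
  ... | zero  | y     = cong (ℕ._* monomial A (Vec.map (ℕ._⊓ suc N) u))
                          (trans (cap-power a v N (inj₁ eq)) eq)
  ... | suc x | zero  = trans (cong (a ℕ.^ (v ℕ.⊓ suc N) ℕ.*_)
                          (trans (cap-monomial A u N (subst (ℕ._≤ N) (sym eq′) ℕ.z≤n)) eq′))
                          (trans (ℕ.*-zeroʳ (a ℕ.^ (v ℕ.⊓ suc N))) (sym (ℕ.*-zeroʳ x)))
  ... | suc x | suc y = cong₂ ℕ._*_
    (trans (cap-power a v N (inj₂ (subst (ℕ._≤ N) (sym eq) (ℕ.≤-trans (ℕ.m≤m*n (suc x) (suc y)) h)))) eq)
    (trans (cap-monomial A u N (subst (ℕ._≤ N) (sym eq′) (ℕ.≤-trans (ℕ.m≤n*m (suc y) (suc x)) h))) eq′)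

any-bounded? : ∀ {r} N {Q : Vec ℕ r → Set} → (∀ u → Dec (Q u)) →
  Dec (∃ λ u → All (ℕ._≤ N) u × Q u)
any-bounded? {zero} N Q? = map′ (λ q → [] , [] , q) (λ where ([] , [] , q) → q) (Q? [])
any-bounded? {suc r} N Q? = map′
  (λ where (v , ℕ.s≤s v≤N , u , u≤N , q) → (v ∷ u) , (v≤N ∷ u≤N) , q)
  (λ where ((v ∷ u) , (v≤N ∷ u≤N) , q) → v , ℕ.s≤s v≤N , u , u≤N , q)
  (ℕ.anyUpTo? (λ v → any-bounded? N (λ u → Q? (v ∷ u))) (suc N))

monomial? : ∀ {r} (A : Vec ℕ r) x → Dec (∃ λ u → monomial A u ≡ x)
monomial? A x = map′
  (λ where (u , _ , e) → u , e)
  (λ where (u , e) → Vec.map (ℕ._⊓ suc x) u , capped u ,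
                     trans (cap-monomial A u x (ℕ.≤-reflexive e)) e)
  (any-bounded? (suc x) (λ u → monomial A u ℕ.≟ x))
  where
  capped : ∀ {r} (u : Vec ℕ r) → All (ℕ._≤ suc x) (Vec.map (ℕ._⊓ suc x) u)
  capped []      = []
  capped (v ∷ u) = ℕ.m⊓n≤n v (suc x) ∷ capped u

H? : ∀ {r} (A : Vec ℕ r) n x → Dec (H A n x)
H? A n x = (x ℕ.<? n) ×-dec monomial? A x

p : ∀ {r} → Vec ℕ r → ℕ → ℕ
p A n = length (filter (H? A n) (upTo n))

generator-nonZero : ∀ {n r m} {A : Vec ℕ r} →
  All (λ a → 2 ℕ.≤ a × a ℕ.< n) A → m IsMinOf A → ℕ.NonZero m
generator-nonZero A⊆ (m∈A , _) = ℕ.>-nonZero (ℕ.<⇒≤ (proj₁ (All.lookup A⊆ m∈A)))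

range-nonZero : ∀ {n r m} {A : Vec ℕ r} →
  All (λ a → 2 ℕ.≤ a × a ℕ.< n) A → m IsMinOf A → ℕ.NonZero n
range-nonZero A⊆ (m∈A , _) = ℕ.>-nonZero (ℕ.m<n⇒0<n (proj₂ (All.lookup A⊆ m∈A)))

-- The empty product 1 is counted, since n exceeds a generator.
p-nonZero : ∀ {n r m} {A : Vec ℕ r} →
  All (λ a → 2 ℕ.≤ a × a ℕ.< n) A → m IsMinOf A → ℕ.NonZero (p A n)
p-nonZero {n} {A = A} A⊆ (m∈A , _) with All.lookup A⊆ m∈A
... | 2≤m , m<n = ℕ.>-nonZero (∈-length (∈-filter⁺ (H? A n) (∈-upTo⁺ 1<n)
    (1<n , Vec.replicate _ 0 , empty-product A)))
  where
  1<n : 1 ℕ.< n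
  1<n = ℕ.<-trans 2≤m m<n
  empty-product : ∀ {r} (A : Vec ℕ r) → monomial A (Vec.replicate r 0) ≡ 1
  empty-product []      = refl
  empty-product (a ∷ A) = trans (ℕ.*-identityˡ _) (empty-product A)

-- If R^t < n ≤ R^(t+1), every exponent vector of degree at most t gives an element
-- of H_A(n), and independence keeps these apart; since there are at least
-- (t+1)^r / r! such vectors, (t+1)^r ≤ r! p_A(n).  Therefore
-- log n ≤ (t+1) log R ≤ K log m (r! p_A(n))^(1/r), which is stronger than the
-- claim by a factor 4.
module Submission where

open import Data.Integer.Base using (+_)
open import Data.Nat.Base using (ℕ; NonZero; _≤_; _<_; _!)
open import Data.Nat.Properties using (_!≢0)
open import Data.Product using (∃; ∃₂; _×_; _,_; proj₁; proj₂)
open import Data.Rational.Base using (_/_)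
open import Data.Vec.Base using (Vec)
open import Data.Vec.Relation.Unary.All using (All)
open import Data.Vec.Relation.Unary.Unique.Propositional using (Unique)
open import Defs

open import Algebra.Bundles using (CommutativeRing)
open import Data.Empty using (⊥; ⊥-elim)
open import Data.Fin.Base using (zero; suc)
open import Data.Fin.Properties using (injective⇒≤)
open import Data.List.Base as List using (List; []; _∷_; _++_; length; upTo; filter)
open import Data.List.Membership.Propositional using () renaming (_∈_ to _∈ₗ_)
open import Data.List.Membership.Propositional.Properties
  using (∈-filter⁺; ∈-upTo⁺; ∈-lookup; ∈-map⁻)
open import Data.List.Membership.Setoid.Properties using (index-injective)
open import Data.List.Properties using (length-map; length-++)
open import Data.List.Relation.Binary.Subset.Propositional using (_⊆_)
import Data.List.Relation.Unary.All as Allₗ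
import Data.List.Relation.Unary.All.Properties as Allₗ
open import Data.List.Relation.Unary.Any using (index)
import Data.List.Relation.Unary.Unique.Propositional as Listₗ
import Data.List.Relation.Unary.Unique.Propositional.Properties as Uniqueₗ
open import Data.Nat.Base using (zero; suc; z≤n; s≤s; _+_; _*_; _^_; >-nonZero; >-nonZero⁻¹)
import Data.Nat.Properties as ℕ
open import Data.Nat.Tactic.RingSolver using (solve-∀)
open import Data.Rational.Base as ℚ using (ℚ; 0ℚ; 1ℚ)
import Data.Rational.Properties as ℚ
open import Data.Rational.Solver using (module +-*-Solver)
open import Data.Sum.Base using (inj₁; inj₂)
import Data.Vec.Base as Vec
import Data.Vec.Properties as Vec
import Data.Vec.Relation.Unary.All as All
open import Relation.Binary.PropositionalEquality
  using (_≡_; refl; sym; trans; cong; cong₂; subst; subst₂; setoid)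
open import Relation.Nullary using (¬_; yes; no; contradiction)
open import Algebra.Properties.CommutativeSemiring.Exp
  (CommutativeRing.commutativeSemiring ℚ.+-*-commutativeRing)
  using (^-assocʳ; ^-distrib-*) renaming (_^_ to _^ℚ_)

-- Counting exponent vectors

-- Splitting the leading factor `suc y` as `1 + y` leaves `y` times the previous case, to which the
-- induction applies. This is the mean value bound for powers.
power-step : ∀ r y → suc y ^ suc r ≤ y ^ suc r + suc r * suc y ^ r
power-step zero    y = ℕ.≤-reflexive (identity y)
  where
  identity : ∀ y → suc y * 1 ≡ y * 1 + 1 * 1
  identity = solve-∀
power-step (suc r) y = begin
  suc y * suc y ^ suc r                            ≤⟨ ℕ.+-monoʳ-≤ (suc y ^ suc r) (ℕ.*-monoʳ-≤ y (power-step r y)) ⟩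
  -- Adding `suc r * suc y ^ r` completes the coefficient `suc r * y` to `suc r * suc y`.
  suc y ^ suc r + y * (y ^ suc r + suc r * suc y ^ r) ≤⟨ ℕ.m≤m+n _ (suc r * suc y ^ r) ⟩
  _                                                ≡⟨ identity r y (suc y ^ r) (y ^ suc r) ⟩
  y * y ^ suc r + suc (suc r) * suc y ^ suc r      ∎
  where
  open ℕ.≤-Reasoning
  identity : ∀ r y z w →
    (suc y * z + y * (w + suc r * z)) + suc r * z ≡ y * w + suc (suc r) * (suc y * z)
  identity = solve-∀

increment : ∀ {r} → Vec ℕ (suc r) → Vec ℕ (suc r)
increment (x Vec.∷ u) = suc x Vec.∷ u

increment-injective : ∀ {r} {u v : Vec ℕ (suc r)} → increment u ≡ increment v → u ≡ v
increment-injective {u = _ Vec.∷ _} {_ Vec.∷ _} refl = refl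

-- The exponent vectors of total degree at most t, split by whether the first entry is 0.
simplex : ∀ r → ℕ → List (Vec ℕ r)
simplex zero    t       = Vec.[] ∷ []
simplex (suc r) zero    = List.map (0 Vec.∷_) (simplex r zero)
simplex (suc r) (suc t) = List.map (0 Vec.∷_) (simplex r (suc t)) ++ List.map increment (simplex (suc r) t)

simplex-unique : ∀ r t → Listₗ.Unique (simplex r t)
simplex-unique zero    t       = Allₗ.[] Listₗ.∷ Listₗ.[]
simplex-unique (suc r) zero    = Uniqueₗ.map⁺ Vec.∷-injectiveʳ (simplex-unique r zero)
simplex-unique (suc r) (suc t) = Uniqueₗ.++⁺
  (Uniqueₗ.map⁺ Vec.∷-injectiveʳ (simplex-unique r (suc t)))
  (Uniqueₗ.map⁺ increment-injective (simplex-unique (suc r) t))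
  λ where (v∈ , w∈) → disjoint-parts (∈-map⁻ _ v∈) (∈-map⁻ _ w∈)
  where
  disjoint-parts : ∀ {v xs ys} →
    (∃ λ u → u ∈ₗ xs × v ≡ 0 Vec.∷ u) → (∃ λ u → u ∈ₗ ys × v ≡ increment u) → ⊥
  disjoint-parts (_ , _ , refl) (_ Vec.∷ _ , _ , ())

-- The sizes obey Pascal's rule, and `power-step` shows that (t+1)^r / r! grows no faster under the
-- same recursion.
simplex-length : ∀ r t → suc t ^ r ≤ r ! * length (simplex r t)
simplex-length zero    t    = s≤s z≤n
simplex-length (suc r) zero = begin
  1 * 1 ^ r                                ≡⟨ ℕ.*-identityˡ (1 ^ r) ⟩
  1 ^ r                                    ≤⟨ simplex-length r zero ⟩
  r ! * length (simplex r zero)            ≤⟨ ℕ.*-monoˡ-≤ (length (simplex r zero)) (ℕ.m≤m+n (r !) (r * r !)) ⟩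
  suc r ! * length (simplex r zero)        ≡⟨ cong (suc r ! *_) (length-map (0 Vec.∷_) (simplex r zero)) ⟨
  suc r ! * length (simplex (suc r) zero)  ∎
  where open ℕ.≤-Reasoning
simplex-length (suc r) (suc t) = begin
  suc (suc t) ^ suc r                                 ≤⟨ power-step r (suc t) ⟩
  suc t ^ suc r + suc r * suc (suc t) ^ r             ≤⟨ ℕ.+-mono-≤ (simplex-length (suc r) t) (ℕ.*-monoʳ-≤ (suc r) (simplex-length r (suc t))) ⟩
  suc r ! * b + suc r * (r ! * a)                     ≡⟨ identity (suc r) (r !) a b ⟩
  suc r ! * (a + b)                                   ≡⟨ cong (suc r ! *_) (sym split) ⟩
  suc r ! * length (simplex (suc r) (suc t))          ∎
  where
  open ℕ.≤-Reasoning
  a b : ℕ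
  a = length (simplex r (suc t))
  b = length (simplex (suc r) t)
  identity : ∀ s f a b → (s * f) * b + s * (f * a) ≡ (s * f) * (a + b)
  identity = solve-∀
  split : length (simplex (suc r) (suc t)) ≡ a + b
  split = trans (length-++ (List.map (0 Vec.∷_) (simplex r (suc t))))
    (cong₂ _+_ (length-map (0 Vec.∷_) (simplex r (suc t))) (length-map increment (simplex (suc r) t)))

-- Each `increment` contributes one generator, hence at most one factor `R`; a leading 0 contributes
-- a factor 1.
simplex-monomial≤ : ∀ {r R} {A : Vec ℕ r} .{{_ : NonZero R}} → All (_≤ R) A →
  ∀ t → Allₗ.All (λ u → monomial A u ≤ R ^ t) (simplex r t)
simplex-monomial≤ {R = R} All.[] t = ℕ.m^n>0 R t Allₗ.∷ Allₗ.[]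
simplex-monomial≤ {A = a Vec.∷ A} (_ All.∷ A≤R) zero = Allₗ.map⁺
  (Allₗ.map (ℕ.≤-trans (ℕ.≤-reflexive (ℕ.*-identityˡ _))) (simplex-monomial≤ A≤R zero))
simplex-monomial≤ {R = R} {A = a Vec.∷ A} (a≤R All.∷ A≤R) (suc t) = Allₗ.++⁺
  (Allₗ.map⁺ (Allₗ.map (ℕ.≤-trans (ℕ.≤-reflexive (ℕ.*-identityˡ _))) (simplex-monomial≤ A≤R (suc t))))
  (Allₗ.map⁺ (Allₗ.map (λ {u} → step u) (simplex-monomial≤ (a≤R All.∷ A≤R) t)))
  where
  step : ∀ u → monomial (a Vec.∷ A) u ≤ R ^ t → monomial (a Vec.∷ A) (increment u) ≤ R ^ suc t
  step (v Vec.∷ u) h =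
    ℕ.≤-trans (ℕ.≤-reflexive (ℕ.*-assoc a (a ^ v) (monomial A u))) (ℕ.*-mono-≤ a≤R h)

-- Comparing the simplex with the counting function

lookup-injective : ∀ {X : Set} {xs : List X} → Listₗ.Unique xs →
  ∀ {i j} → List.lookup xs i ≡ List.lookup xs j → i ≡ j
lookup-injective (x∉ Listₗ.∷ xs!) {zero}  {zero}  eq = refl
lookup-injective (x∉ Listₗ.∷ xs!) {zero}  {suc j} eq = contradiction eq (Allₗ.lookup x∉ (∈-lookup j))
lookup-injective (x∉ Listₗ.∷ xs!) {suc i} {zero}  eq = contradiction (sym eq) (Allₗ.lookup x∉ (∈-lookup i))
lookup-injective (x∉ Listₗ.∷ xs!) {suc i} {suc j} eq = cong suc (lookup-injective xs! eq)

-- Pigeonhole: sending a position in `xs` to the position of its entry in `ys` is injective, because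
-- `xs` has no repetitions.
unique-⊆⇒length≤ : ∀ {X : Set} {xs ys : List X} → Listₗ.Unique xs → xs ⊆ ys → length xs ≤ length ys
unique-⊆⇒length≤ xs! xs⊆ys = injective⇒≤ {f = λ i → index (xs⊆ys (∈-lookup i))} λ eq →
  lookup-injective xs! (index-injective (setoid _) (xs⊆ys (∈-lookup _)) (xs⊆ys (∈-lookup _)) eq)

-- Independence makes the values of `monomial` on the simplex distinct, and `R ^ t < n` puts all of
-- them among the numbers that `p A n` counts.
simplex-length≤p : ∀ {n r R t} {A : Vec ℕ r} .{{_ : NonZero R}} → MultiplicativelyIndependent A →
  All (_≤ R) A → R ^ t < n → length (simplex r t) ≤ p A n
simplex-length≤p {n} {r} {t = t} {A} independent A≤R R^t<n =
  subst (_≤ p A n) (length-map (monomial A) (simplex r t))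
    (unique-⊆⇒length≤ (Uniqueₗ.map⁺ independent (simplex-unique r t)) λ x∈ → member (∈-map⁻ (monomial A) x∈))
  where
  member : ∀ {x} → (∃ λ u → u ∈ₗ simplex r t × x ≡ monomial A u) → x ∈ₗ filter (H? A n) (upTo n)
  member (u , u∈ , refl) = ∈-filter⁺ (H? A n) (∈-upTo⁺ small) (small , u , refl)
    where
    small : monomial A u < n
    small = ℕ.≤-<-trans (Allₗ.lookup (simplex-monomial≤ A≤R t) u∈) R^t<n

-- Integer logarithms

n<b^n : ∀ {b} → 1 < b → ∀ n → n < b ^ n
n<b^n 1<b zero    = s≤s z≤n
n<b^n {b} 1<b (suc n) = ℕ.≤-trans (s≤s (n<b^n 1<b n)) (ℕ.^-monoʳ-< b 1<b (ℕ.n<1+n n))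

-- The search descends from exponent `n`, where `n < b ^ n`, to the first power below `n`; since
-- `1 < n`, it stops at exponent 0 at the latest.
floor-log : ∀ {b n} → 1 < b → 1 < n → ∃ λ t → b ^ t < n × n ≤ b ^ suc t
floor-log {b} {n} 1<b 1<n = search n (ℕ.<⇒≤ (n<b^n 1<b n))
  where
  search : ∀ j → n ≤ b ^ j → ∃ λ t → b ^ t < n × n ≤ b ^ suc t
  search zero    n≤1 = contradiction n≤1 (ℕ.<⇒≱ 1<n)
  search (suc j) n≤ with b ^ j ℕ.<? n
  ... | yes b^j<n = j , b^j<n , n≤
  ... | no  b^j≮n = search j (ℕ.≮⇒≥ b^j≮n)

-- Rational bounds for the exponential

opaque
  unfolding ι

  ι-1 : ι 1 ≡ 1ℚ
  ι-1 = refl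

  ι-mono-≤ : ∀ {a b} → a ≤ b → ι a ℚ.≤ ι b
  ι-mono-≤ {b = b} z≤n       = 0≤ι b
  ι-mono-≤ {suc a} {suc b} (s≤s a≤b) =
    subst₂ ℚ._≤_ (sym (ι-suc a)) (sym (ι-suc b)) (ℚ.+-monoʳ-≤ 1ℚ (ι-mono-≤ a≤b))

ι-^ : ∀ a k → ι (a ^ k) ≡ ι a ^ℚ k
ι-^ a zero    = ι-1
ι-^ a (suc k) = trans (ι-* a (a ^ k)) (cong (ι a ℚ.*_) (ι-^ a k))

*-mono-<-pos : ∀ {a b c d} → 0ℚ ℚ.< a → 0ℚ ℚ.< c → a ℚ.< b → c ℚ.< d → a ℚ.* c ℚ.< b ℚ.* d
*-mono-<-pos 0<a 0<c a<b c<d = ℚ.<-trans (*<ʳ 0<c a<b) (*<ˡ (ℚ.<-trans 0<a a<b) c<d)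

1<x⇒1<x^n : ∀ n {x} → 1ℚ ℚ.< x → 1ℚ ℚ.< x ^ℚ suc n
1<x⇒1<x^n zero    {x} 1<x = subst (1ℚ ℚ.<_) (sym (ℚ.*-identityʳ x)) 1<x
1<x⇒1<x^n (suc n) {x} 1<x = subst (ℚ._< x ^ℚ suc (suc n)) (ℚ.*-identityˡ 1ℚ)
  (*-mono-<-pos 0<1 0<1 1<x (1<x⇒1<x^n n 1<x))

^-cancel-< : ∀ n {x y} → 0ℚ ℚ.< y → x ^ℚ n ℚ.< y ^ℚ n → x ℚ.< y
^-cancel-< n {x} {y} 0<y x^n<y^n with <-cases x y
... | inj₁ x<y = x<y
... | inj₂ y≤x = ⊥-elim (ℚ.<-irrefl refl (ℚ.<-≤-trans x^n<y^n (^-mono n 0<y y≤x)))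

base-zero : ∀ k → base k 0ℚ ≡ 1ℚ
base-zero k = trans (cong (1ℚ ℚ.+_) (ℚ.*-zeroˡ (recip k))) (ℚ.+-identityʳ 1ℚ)

-- Otherwise monotonicity would put `q` below a stage at exponent 0, and all of those equal 1.
<exp⇒pos : ∀ {v q} → 1ℚ ℚ.≤ q → q <exp v → 0ℚ ℚ.< v
<exp⇒pos {v} {q} 1≤q e with <-cases 0ℚ v
... | inj₁ 0<v = 0<v
... | inj₂ v≤0 with <exp-mono {v} {0ℚ} {q} v≤0 e
... | k , _ , q<1 = ⊥-elim (ℚ.<-irrefl refl (ℚ.≤-<-trans 1≤q
  (subst (q ℚ.<_) (trans (cong (_^ℚ suc k) (base-zero k)) (1^n≡1 (suc k))) q<1)))

<exp⇒< : ∀ {v q q′} → q <exp v → q′ >exp v → q ℚ.< q′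
<exp⇒< {v} {q} {q′} e e′ with <-cases q q′
... | inj₁ q<q′ = q<q′
-- Disjointness needs a single number on both sides; as `q′` may equal `q`, the lower number is
-- first moved up a little.
... | inj₂ q′≤q with <exp-dense {v} {q} e
... | q″ , q<q″ , e″ = ⊥-elim (exp-disjoint {v} {q″} e″ (>exp-up {v} {q′} {q″} (ℚ.≤-<-trans q′≤q q<q″) e′))

-- The index is chosen so that its successor is `suc k * suc l`; the finer stage then cancels the
-- factor `suc l` in the exponent exactly.
base-scale : ∀ k l v → base (l + k * suc l) (ℚ.- (ι (suc l) ℚ.* v)) ≡ base k (ℚ.- v)
base-scale k l v = cong (1ℚ ℚ.+_) (trans
  (solve 3 (λ s v ρ → (:- (s :* v)) :* ρ := (:- v) :* (ρ :* s)) refl (ι (suc l)) v (recip (l + k * suc l)))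
  (cong ((ℚ.- v) ℚ.*_) (recip-product k l)))
  where open +-*-Solver

power-scale : ∀ k l v → base (l + k * suc l) (ℚ.- (ι (suc l) ℚ.* v)) ^ℚ suc (l + k * suc l) ≡
  (base k (ℚ.- v) ^ℚ suc k) ^ℚ suc l
power-scale k l v = trans (cong (_^ℚ suc (l + k * suc l)) (base-scale k l v))
  (sym (^-assocʳ (base k (ℚ.- v)) (suc k) (suc l)))

-- By `power-scale` it suffices to raise the inequality that witnesses `q >exp v` to the power
-- `suc l`.
>exp-power⁺ : ∀ l {v q} → q >exp v → q ^ℚ suc l >exp ι (suc l) ℚ.* v
>exp-power⁺ l {v} {q} (k , 0<b , h) = l + k * suc l ,
  subst (0ℚ ℚ.<_) (sym (base-scale k l v)) 0<b ,
  subst (1ℚ ℚ.<_)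
    (trans (^-distrib-* q (base k (ℚ.- v) ^ℚ suc k) (suc l)) (cong (q ^ℚ suc l ℚ.*_) (sym (power-scale k l v))))
    (1<x⇒1<x^n l h)

-- If the product exceeded 1, a multiplier slightly smaller than `ρ` would still make it do so.
*≤1 : ∀ {d ρ} → 0ℚ ℚ.< d → (∀ {x} → 1ℚ ℚ.< x ℚ.* d → ρ ℚ.≤ x) → ρ ℚ.* d ℚ.≤ 1ℚ
*≤1 {d} {ρ} 0<d ρ≤ with <-cases 1ℚ (ρ ℚ.* d)
... | inj₂ ρd≤1 = ρd≤1
... | inj₁ 1<ρd with scale-dense {d} {ρ} 0<d 1<ρd
... | x , x<ρ , 1<xd = ⊥-elim (ℚ.<-irrefl refl (ℚ.<-≤-trans x<ρ (ρ≤ {x} 1<xd)))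

-- The last hypothesis expresses ρ ≤ e^v through upper approximations alone. At stage `k` it gives
-- ρD ≤ 1, and powers of this are compared with 1 < q D^(l+1).
>exp-power⁻ : ∀ l {v q ρ} → 0ℚ ℚ.< ρ → q >exp ι (suc l) ℚ.* v → (∀ {x} → x >exp v → ρ ℚ.≤ x) →
  ρ ^ℚ suc l ℚ.< q
>exp-power⁻ l {v} {q} {ρ} 0<ρ e@(k , 0<b , h) ρ≤ = *<-cancelʳ {D ^ℚ suc l} {ρ ^ℚ suc l} {q}
  (^-pos {D} (suc l) 0<D) (ℚ.≤-<-trans ρD^≤1 1<qD^)
  where
  D : ℚ
  D = base k (ℚ.- v) ^ℚ suc k
  0<b′ : 0ℚ ℚ.< base k (ℚ.- v)
  0<b′ = subst (0ℚ ℚ.<_) (base-scale k l v) (base-pos-lift k l {ℚ.- (ι (suc l) ℚ.* v)} 0<b)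
  0<D : 0ℚ ℚ.< D
  0<D = ^-pos {base k (ℚ.- v)} (suc k) 0<b′
  ρD≤1 : ρ ℚ.* D ℚ.≤ 1ℚ
  ρD≤1 = *≤1 {D} {ρ} 0<D λ {x} 1<xD → ρ≤ {x} (k , 0<b′ , 1<xD)
  ρD^≤1 : ρ ^ℚ suc l ℚ.* D ^ℚ suc l ℚ.≤ 1ℚ
  ρD^≤1 = subst₂ ℚ._≤_ (^-distrib-* ρ D (suc l)) (1^n≡1 (suc l))
    (^-mono {ρ ℚ.* D} {1ℚ} (suc l) (0<* 0<ρ 0<D) ρD≤1)
  1<qD^ : 1ℚ ℚ.< q ℚ.* D ^ℚ suc l
  1<qD^ = ℚ.<-≤-trans h (*≤ˡ {q} (ℚ.<⇒≤ (>exp-pos {ι (suc l) ℚ.* v} {q} e))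
    -- `power-lift` refines the given witness to the stage at which its power is `D` raised to
    -- `suc l`.
    (ℚ.≤-trans (power-lift k l {ℚ.- (ι (suc l) ℚ.* v)} 0<b) (ℚ.≤-reflexive (power-scale k l v))))

-- Cuts of the real operations

-- Locate `x` between `q` and a slightly larger `q′` still below `y`: if `q′` were above `x`, it
-- would witness `x <ᴿ y`.
≮⇒≥ᴿ : ∀ {x y} → ¬ (x <ᴿ y) → x ≥ᴿ y
≮⇒≥ᴿ {x} {y} x≮y q Lq with L-round y Lq
... | q′ , q<q′ , Lq′ with located x q<q′
... | inj₁ Lx  = Lx
... | inj₂ Uq′ = contradiction (q′ , Uq′ , Lq′) x≮y

*ᴿ-upper⁻ : ∀ {x y s} → U (x *ᴿ y) s → ∃₂ λ b d → U x b × U y d × b ℚ.* d ℚ.< s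
*ᴿ-upper⁻ (box _ Ub _ Ud , _ , _ , _ , h) = _ , _ , Ub , Ud , h

-- With 0 as the lower edge for `x`, two corners vanish; since `b` is positive, the corner at any
-- lower bound of `y` stays below `b * d`.
*ᴿ-upper⁺ : ∀ {x y b d s} → L x 0ℚ → U x b → U y d → 0ℚ ℚ.< d → b ℚ.* d ℚ.< s → U (x *ᴿ y) s
*ᴿ-upper⁺ {x} {y} {b} {d} {s} 0<x Ub Ud 0<d bd<s with L-inhab y
... | c , Lc = box 0<x Ub Lc Ud , zero-corner c , zero-corner d ,
  ℚ.<-trans (*<ˡ 0<b (L<U y Lc Ud)) bd<s , bd<s
  where
  0<b : 0ℚ ℚ.< b
  0<b = L<U x 0<x Ub
  zero-corner : ∀ z → 0ℚ ℚ.* z ℚ.< s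
  zero-corner z = subst (ℚ._< s) (sym (ℚ.*-zeroˡ z)) (ℚ.<-trans (0<* 0<b 0<d) bd<s)

-- A lower bound `c` of the inverse comes with an `s` above `y` such that cs < 1, so qs < acs < a.
-- The signs of `d` and then `a` follow from 1 < dt and 0 < q < ad.
÷ᴿ-lower⁻ : ∀ {x y q} {{_ : Positive y}} → 0ℚ ℚ.< q → L (x ÷ᴿ y) q → ∃ λ s → U y s × L x (q ℚ.* s)
÷ᴿ-lower⁻ {x} {y} {q} {{positive 0<y}} 0<q
  (box {a} {b} {c} {d} La Ub (s , Us , cs<1) (t , Lt , 0<t , 1<dt) , q<ac , q<ad , q<bc , q<bd) =
  s , Us , L-down x (ℚ.<-trans (*<ʳ 0<s q<ac) acs<a) La
  where
  0<s : 0ℚ ℚ.< s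
  0<s = L<U y 0<y Us
  0<d : 0ℚ ℚ.< d
  0<d = *<-cancelʳ {t} {0ℚ} {d} 0<t (subst (ℚ._< d ℚ.* t) (sym (ℚ.*-zeroˡ t)) (ℚ.<-trans 0<1 1<dt))
  0<a : 0ℚ ℚ.< a
  0<a = *<-cancelʳ {d} {0ℚ} {a} 0<d (subst (ℚ._< a ℚ.* d) (sym (ℚ.*-zeroˡ d)) (ℚ.<-trans 0<q q<ad))
  acs<a : a ℚ.* c ℚ.* s ℚ.< a
  acs<a = subst₂ ℚ._<_ (sym (ℚ.*-assoc a c s)) (ℚ.*-identityʳ a) (*<ˡ 0<a cs<1)

log-upper-pos : ∀ {m q} .{{_ : NonZero m}} → U (log (fromℕ m)) q → 0ℚ ℚ.< q
log-upper-pos {m} {q} (x , m<x , e) = <exp⇒pos {q} {x}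
  (ℚ.≤-trans (subst (ℚ._≤ ι m) ι-1 (ι-mono-≤ (>-nonZero⁻¹ m))) (ℚ.<⇒≤ m<x)) e

-- Roots and real powers of natural numbers

opaque
  unfolding recip

  recip≡/ : ∀ l → recip l ≡ + 1 / suc l
  recip≡/ l = refl

-- An upper bound `v` of (log N)/r, with r = `suc l`, exceeds d/r for some `d` above log N; taking
-- r-th powers gives x^r > e^d > N.
root-upper : ∀ {N} l {x} .{{_ : NonZero N}} → U (fromℕ N ^ᴿ fromℚ (+ 1 / suc l)) x → ι N ℚ.< x ^ℚ suc l
root-upper {N} l {x} (v , Uv , x>e^v) with *ᴿ-upper⁻ {fromℚ (+ 1 / suc l)} {log (fromℕ N)} Uv
... | b , d , 1/r<b , Ud@(y , N<y , y<e^d) , bd<v = ℚ.<-trans N<y (<exp⇒< {d} {y} {x ^ℚ suc l} y<e^d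
  (subst (x ^ℚ suc l >exp_) scaled (>exp-power⁺ l {recip l ℚ.* d} {x} (>exp-mono {recip l ℚ.* d} {v} {x} (ℚ.<⇒≤ d/r<v) x>e^v))))
  where
  d/r<v : recip l ℚ.* d ℚ.< v
  d/r<v = ℚ.<-trans (*<ʳ (log-upper-pos {N} Ud) (subst (ℚ._< b) (sym (recip≡/ l)) 1/r<b)) bd<v
  scaled : ι (suc l) ℚ.* (recip l ℚ.* d) ≡ d
  scaled = trans (sym (ℚ.*-assoc (ι (suc l)) (recip l) d)) (trans (cong (ℚ._* d) (ι-recip l)) (ℚ.*-identityˡ d))

-- As w > K log m, a number `x` above e^w lies above m^K; if it were below `R` too, it would belong
-- to both cuts of m^K.
≤-power⇒≤ : ∀ {R m K k q w x} .{{_ : NonZero m}} → L K 0ℚ → fromℕ R ≤ᴿ fromℕ m ^ᴿ K →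
  U K k → U (log (fromℕ m)) q → k ℚ.* q ℚ.< w → x >exp w → ι R ℚ.≤ x
≤-power⇒≤ {R} {m} {K} {w = w} {x} 0<K R≤m^K Uk Uq kq<w x>e^w with <-cases x (ι R)
... | inj₂ R≤x = R≤x
... | inj₁ x<R = ⊥-elim (disjoint (fromℕ m ^ᴿ K) (R≤m^K x x<R)
  (w , *ᴿ-upper⁺ 0<K Uk Uq (log-upper-pos {m} Uq) kq<w , x>e^w))

-- The factor 4 supplies the strict room `k < f`: its upper bound `g` exceeds 1, so k < gk < f.
denominator-upper⁻ : ∀ {K X Y s} → L K 0ℚ → L X 0ℚ → L Y 0ℚ → U (fromℕ 4 *ᴿ K *ᴿ X *ᴿ Y) s →
  ∃₂ λ k f → ∃₂ λ x y → U K k × U X x × U Y y × k ℚ.< f × f ℚ.* (x ℚ.* y) ℚ.< s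
denominator-upper⁻ {K} {X} {Y} {s} 0<K 0<X 0<Y Us with *ᴿ-upper⁻ {fromℕ 4 *ᴿ K *ᴿ X} {Y} Us
... | e , y , Ue , Uy , ey<s with *ᴿ-upper⁻ {fromℕ 4 *ᴿ K} {X} Ue
... | f , x , Uf , Ux , fx<e with *ᴿ-upper⁻ {fromℕ 4} {K} Uf
... | g , k , 4<g , Uk , gk<f = k , f , x , y , Uk , Ux , Uy ,
  ℚ.<-trans (subst (ℚ._< g ℚ.* k) (ℚ.*-identityˡ k) (*<ʳ (L<U K 0<K Uk) 1<g)) gk<f ,
  subst (ℚ._< s) (ℚ.*-assoc f x y) (ℚ.<-trans (*<ʳ (L<U Y 0<Y Uy) fx<e) ey<s)
  where
  1<g : 1ℚ ℚ.< g
  1<g = ℚ.≤-<-trans (subst (ℚ._≤ ι 4) ι-1 (ι-mono-≤ (s≤s z≤n))) 4<g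

-- With r = `suc l`, compare r-th powers: a^r ≤ FN < x^r y^r = (xy)^r.
root-product : ∀ {F N a} l {x y} .{{_ : NonZero F}} .{{_ : NonZero N}} → a ^ suc l ≤ F * N →
  U (fromℕ F ^ᴿ fromℚ (+ 1 / suc l)) x → U (fromℕ N ^ᴿ fromℚ (+ 1 / suc l)) y →
  0ℚ ℚ.< x → 0ℚ ℚ.< y → ι a ℚ.< x ℚ.* y
root-product {F} {N} {a} l {x} {y} a^r≤FN Ux Uy 0<x 0<y = ^-cancel-< (suc l) (0<* 0<x 0<y)
  (subst₂ ℚ._<_ (ι-^ a (suc l)) (sym (^-distrib-* x y (suc l)))
    (ℚ.≤-<-trans (ℚ.≤-trans (ι-mono-≤ a^r≤FN) (ℚ.≤-reflexive (ι-* F N)))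
      (*-mono-<-pos (0<ι F) (0<ι N) (root-upper {F} l {x} Ux) (root-upper {N} l {y} Uy))))

-- Here `q` and `s` are upper bounds of log m and of the denominator, so (t+1)fq < xyfq < qs. Since
-- R ≤ e^(fq), this gives R^(t+1) ≤ e^((t+1)fq) < z.
power-below : ∀ {R m F N K q s z} l t .{{_ : NonZero R}} .{{_ : NonZero m}} .{{_ : NonZero F}} .{{_ : NonZero N}} →
  suc t ^ suc l ≤ F * N → L K 0ℚ → fromℕ R ≤ᴿ fromℕ m ^ᴿ K → U (log (fromℕ m)) q →
  U (fromℕ 4 *ᴿ K *ᴿ (fromℕ F ^ᴿ fromℚ (+ 1 / suc l)) *ᴿ (fromℕ N ^ᴿ fromℚ (+ 1 / suc l))) s →
  z >exp q ℚ.* s → ι R ^ℚ suc t ℚ.< z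
power-below {R} {m} {F} {N} {K} {q} {s} {z} l t bound 0<K R≤m^K Uq Us z>e^qs =
  go (denominator-upper⁻ 0<K 0<X 0<Y Us)
  where
  X Y : ℝ
  X = fromℕ F ^ᴿ fromℚ (+ 1 / suc l)
  Y = fromℕ N ^ᴿ fromℚ (+ 1 / suc l)
  0<X : L X 0ℚ
  0<X = 0∈L (^-positive {fromℕ F} {fromℚ (+ 1 / suc l)})
  0<Y : L Y 0ℚ
  0<Y = 0∈L (^-positive {fromℕ N} {fromℚ (+ 1 / suc l)})
  0<q : 0ℚ ℚ.< q
  0<q = log-upper-pos {m} Uq
  go : (∃₂ λ k f → ∃₂ λ x y → U K k × U X x × U Y y × k ℚ.< f × f ℚ.* (x ℚ.* y) ℚ.< s) → ι R ^ℚ suc t ℚ.< z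
  go (k , f , x , y , Uk , Ux , Uy , k<f , fxy<s) = >exp-power⁻ t (0<ι R)
    (>exp-mono {ι (suc t) ℚ.* (f ℚ.* q)} {q ℚ.* s} {z} (ℚ.<⇒≤ [t+1]fq<qs) z>e^qs)
    (≤-power⇒≤ {R} {m} {K} 0<K R≤m^K Uk Uq (*<ʳ 0<q k<f))
    where
    0<f : 0ℚ ℚ.< f
    0<f = ℚ.<-trans (L<U K 0<K Uk) k<f
    t+1<xy : ι (suc t) ℚ.< x ℚ.* y
    t+1<xy = root-product {F} {N} l {x} {y} bound Ux Uy (L<U X 0<X Ux) (L<U Y 0<Y Uy)
    [t+1]fq<qs : ι (suc t) ℚ.* (f ℚ.* q) ℚ.< q ℚ.* s
    [t+1]fq<qs = ℚ.<-trans (*<ʳ (0<* 0<f 0<q) t+1<xy) (subst (ℚ._< q ℚ.* s)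
      (solve 4 (λ q f x y → q :* (f :* (x :* y)) := x :* y :* (f :* q)) refl q f x y)
      (*<ˡ 0<q fxy<s))
      where open +-*-Solver

-- Assembling the inequality

-- A rational `q` between log m and a larger quotient would give `s` above `D` and e^(qs) < z < n,
-- against n ≤ R^(t+1) < z. Positivity of `D` is a parameter, so that it can be the proof already
-- present in the goal.
log-bound : ∀ {R m n F N K} l t
  .{{_ : NonZero R}} .{{_ : NonZero m}} .{{_ : NonZero n}} .{{_ : NonZero F}} .{{_ : NonZero N}} →
  let D = fromℕ 4 *ᴿ K *ᴿ fromℕ F ^ᴿ fromℚ (+ 1 / suc l) *ᴿ fromℕ N ^ᴿ fromℚ (+ 1 / suc l) in
  (D>0 : Positive D) → suc t ^ suc l ≤ F * N → n ≤ R ^ suc t → L K 0ℚ → fromℕ R ≤ᴿ fromℕ m ^ᴿ K →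
  log (fromℕ m) ≥ᴿ _÷ᴿ_ (log (fromℕ n)) D {{D>0}}
log-bound {R} {m} {n} {F} {N} {K} l t D>0 bound n≤R^1+t 0<K R≤m^K =
  ≮⇒≥ᴿ {log (fromℕ m)} {_÷ᴿ_ (log (fromℕ n)) D {{D>0}}} λ (q , Uq , Lq) →
    refute {q} Uq (÷ᴿ-lower⁻ {log (fromℕ n)} {D} {q} {{D>0}} (log-upper-pos {m} Uq) Lq)
  where
  D : ℝ
  D = fromℕ 4 *ᴿ K *ᴿ fromℕ F ^ᴿ fromℚ (+ 1 / suc l) *ᴿ fromℕ N ^ᴿ fromℚ (+ 1 / suc l)
  refute : ∀ {q} → U (log (fromℕ m)) q → (∃ λ s → U D s × L (log (fromℕ n)) (q ℚ.* s)) → ⊥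
  refute {q} Uq (s , Us , z , z<n , z>e^qs) = ℚ.<-irrefl refl
    (ℚ.<-trans z<n (ℚ.≤-<-trans (ℚ.≤-trans (ι-mono-≤ n≤R^1+t) (ℚ.≤-reflexive (ι-^ R (suc t))))
      (power-below {R} {m} {F} {N} {K} {q} {s} {z} l t bound 0<K R≤m^K Uq Us z>e^qs)))

lemma3p3 : ∀ (n r : ℕ) .{{_ : NonZero r}} (A : Vec ℕ r) →
    Unique A →
    (A⊆ : All (λ a → 2 ≤ a × a < n) A) →
    MultiplicativelyIndependent A →
    ∀ (m R : ℕ) (m-min : m IsMinOf A) → R IsMaxOf A →
    ∀ (K : ℝ) (K>1 : fromℕ 1 <ᴿ K) →
    let instance
          m≢0 : NonZero m
          m≢0 = generator-nonZero A⊆ m-min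
          n≢0 : NonZero n
          n≢0 = range-nonZero A⊆ m-min
          p≢0 : NonZero (p A n)
          p≢0 = p-nonZero A⊆ m-min
          r!≢0 : NonZero (r !)
          r!≢0 = r !≢0
          K>0 : Positive K
          K>0 = >1⇒positive K>1
    in
    fromℕ R ≤ᴿ fromℕ m ^ᴿ K →
    log (fromℕ m) ≥ᴿ
      log (fromℕ n) ÷ᴿ
        (fromℕ 4 *ᴿ K *ᴿ fromℕ (r !) ^ᴿ fromℚ (+ 1 / r) *ᴿ fromℕ (p A n) ^ᴿ fromℚ (+ 1 / r))
lemma3p3 n zero    Vec.[] _ _ _ _ _ (() , _) _ _ _ _
lemma3p3 n (suc l) A _ A⊆ independent m R m-min (R∈A , A≤R) K K>1 R≤m^K =
  -- As `R` is itself a generator, 2 ≤ R < n, which `floor-log` requires. The lower bound on `n`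
  -- serves the count, the upper bound the comparison of logarithms.
  let t , R^t<n , n≤R^1+t = floor-log 2≤R (ℕ.<-trans 2≤R (proj₂ (All.lookup A⊆ R∈A)))
  in log-bound {R} {m} {n} {suc l !} {p A n} {K} l t
    {{R≢0}} {{generator-nonZero A⊆ m-min}} {{range-nonZero A⊆ m-min}} {{suc l !≢0}} {{p-nonZero A⊆ m-min}} _
    (ℕ.≤-trans (simplex-length (suc l) t)
      (ℕ.*-monoʳ-≤ (suc l !) (simplex-length≤p {t = t} {{R≢0}} independent A≤R R^t<n)))
    n≤R^1+t (0∈L (>1⇒positive {K} K>1)) R≤m^K
  where
  2≤R : 2 ≤ R
  2≤R = proj₁ (All.lookup A⊆ R∈A)
  R≢0 : NonZero R
  R≢0 = >-nonZero (ℕ.<⇒≤ 2≤R)
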